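{- Let $G$ be a connected graph and let $A_1,A_2,\dots,A_s$ be a sequence of pairwise disjoint independent vertex sets such that: (i) setting $G_0=G$ and $G_i=G_{i-1}-A_i$, each $G_i$ ($i=1,\dots,s$) is connected; (ii) each vertex of $A_i$ ($i=1,\dots,s$) has odd degree in $G_{i-1}$. Then for $i=0,1,\dots,s-1$, $$\gamma_M(G_i)\ \ge\ \frac12\sum_{v\in A_{i+1}}\bigl(d_{G_i}(v)-1\bigr)+\gamma_M(G_{i+1}).$$ In particular, if one of the graphs $G_1,G_2,\dots,G_s$ is upper embeddable, then $G$ is upper embeddable.
   Context: The maximum genus $\gamma_M(H)$ of a connected graph $H$ is the maximum integer $k$ such that $H$ has a (cellular) embedding in the orientable surface of genus $k$. The cycle rank of $H$ is $\beta(H)=|E(H)|-|V(H)|+1$. A connected graph $H$ is upper embeddable if $\gamma_M(H)=\lfloor \beta(H)/2\rfloor$. $d_{G_i}(v)$ is the degree of $v$ in $G_i$. -}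

module Defs where

open import Data.Nat using (ℕ; zero; suc; _+_; _*_; _∸_; _≤_; _<_; _⊔_; _≤ᵇ_; ⌊_/2⌋)
open import Data.Fin using (Fin; toℕ) renaming (zero to fzero; suc to fsuc)
open import Data.Fin.Properties using () renaming (_≟_ to _≟ᶠ_)
open import Data.Bool using (Bool; true; false; _∧_; not; if_then_else_)
open import Data.Product using (Σ; ∃; _×_; _,_; proj₁; proj₂)
open import Relation.Nullary using (does)
open import Relation.Binary.PropositionalEquality using (_≡_)
open import Function using (_∘_)
open import Data.Empty using (⊥)

-- Finite multigraphs (loops and multiple edges allowed).
-- Vertices are Fin nV, edges are Fin nE; edge e joins end e false
-- and end e true.

record Graph : Set where
  field
    nV   : ℕ
    nE   : ℕ
    end  : Fin nE → Bool → Fin nV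

sumFin : {k : ℕ} → (Fin k → ℕ) → ℕ
sumFin {zero}  f = 0
sumFin {suc k} f = f fzero + sumFin (f ∘ fsuc)

count : {k : ℕ} → (Fin k → Bool) → ℕ
count f = sumFin (λ x → if f x then 1 else 0)

iter : {A : Set} → (A → A) → ℕ → A → A
iter f zero    x = x
iter f (suc k) x = f (iter f k x)

allBelow : ℕ → (ℕ → Bool) → Bool
allBelow zero    p = true
allBelow (suc N) p = allBelow N p ∧ p N

Odd : ℕ → Set
Odd n = ∃ λ k → n ≡ suc (2 * k)

module _ (G : Graph) where
  open Graph G

  VSet : Set
  VSet = Fin nV → Bool

  Dart : Set
  Dart = Fin nE × Bool

  vert : Dart → Fin nV
  vert (e , b) = end e b

  θ : Dart → Dart
  θ (e , b) = (e , not b)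

  -- Every graph considered is the induced subgraph G[S] of G on a
  -- vertex subset S; the vertex-deleted subgraph G - A is G[V \ A].
  edgeInᵇ : VSet → Fin nE → Bool
  edgeInᵇ S e = S (end e false) ∧ S (end e true)

  InS : VSet → Fin nV → Set
  InS S v = S v ≡ true

  DartIn : VSet → Dart → Set
  DartIn S d = edgeInᵇ S (proj₁ d) ≡ true

  nVerts : VSet → ℕ
  nVerts S = count S

  nEdges : VSet → ℕ
  nEdges S = count (edgeInᵇ S)

  β : VSet → ℕ
  β S = (nEdges S + 1) ∸ nVerts S

  -- degree of v in G[S] (a loop contributes 2)
  degree : VSet → Fin nV → ℕ
  degree S v = sumFin (λ e →
      (if edgeInᵇ S e ∧ does (end e false ≟ᶠ v) then 1 else 0)
    + (if edgeInᵇ S e ∧ does (end e true  ≟ᶠ v) then 1 else 0))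

  data Walk (S : VSet) : Fin nV → Fin nV → Set where
    here : ∀ {u} → Walk S u u
    step : ∀ {u w} (e : Fin nE) (b : Bool) → edgeInᵇ S e ≡ true →
           end e b ≡ u → Walk S (end e (not b)) w → Walk S u w

  Connected : VSet → Set
  Connected S = (∃ λ v → InS S v) ×
                (∀ u w → InS S u → InS S w → Walk S u w)

  Independent : VSet → Set
  Independent A = ∀ e → (A (end e false) ≡ true × A (end e true) ≡ true) → ⊥

  -- A rotation system of G[S]: a permutation ρ of darts which maps the
  -- darts of G[S] to darts of G[S] at the same vertex, and which acts
  -- cyclically on the set of darts of G[S] at each vertex.
  -- (Its values on darts outside G[S] are irrelevant.)
  record Rotation (S : VSet) : Set where
    field
      ρ       : Dart → Dart
      ρ⁻¹     : Dart → Dart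
      ρρ⁻¹    : ∀ d → ρ (ρ⁻¹ d) ≡ d
      ρ⁻¹ρ    : ∀ d → ρ⁻¹ (ρ d) ≡ d
      closed  : ∀ d → DartIn S d → DartIn S (ρ d)
      atVert  : ∀ d → DartIn S d → vert (ρ d) ≡ vert d
      cyclic  : ∀ d d' → DartIn S d → DartIn S d' → vert d ≡ vert d' →
                ∃ λ k → iter ρ k d ≡ d'

  key : Dart → ℕ
  key (e , b) = 2 * toℕ e + (if b then 1 else 0)

  nDarts : ℕ
  nDarts = 2 * nE

  module _ {S : VSet} (r : Rotation S) where
    open Rotation r

    φ : Dart → Dart
    φ d = ρ (θ d)

    -- d is the representative (key-minimal dart) of its φ-orbit;
    -- orbits have size ≤ nDarts so checking k ≤ nDarts suffices.
    isRep : Dart → Bool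
    isRep d = edgeInᵇ S (proj₁ d) ∧
              allBelow (suc nDarts) (λ k → key d ≤ᵇ key (iter φ k d))

    -- number of faces of the cellular embedding given by r
    -- (the graph with one vertex and no edge has one face)
    faces : ℕ
    faces = 1 ⊔ sumFin (λ e → (if isRep (e , false) then 1 else 0)
                            + (if isRep (e , true)  then 1 else 0))

    -- genus via Euler's formula  |V| - |E| + F = 2 - 2g
    genus : ℕ
    genus = ⌊ (2 + nEdges S) ∸ (nVerts S + faces) /2⌋

  IsMaxGenus : VSet → ℕ → Set
  IsMaxGenus S k = (Σ (Rotation S) λ r → genus r ≡ k) ×
                   (∀ (r : Rotation S) → genus r ≤ k)

  UpperEmbeddable : VSet → Set
  UpperEmbeddable S = ∃ λ k → IsMaxGenus S k × k ≡ ⌊ β S /2⌋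

  -- G_0 = G, G_i = G_{i-1} - A_i, for a sequence A 1, A 2, ... (A 0 unused)
  Gseq : (ℕ → VSet) → ℕ → VSet
  Gseq A zero    v = true
  Gseq A (suc i) v = Gseq A i v ∧ not (A (suc i) v)

{-# OPTIONS --safe #-}
module Submission where

open import Defs hiding (here; step)
open import Data.Nat using (ℕ; zero; suc; _+_; _*_; _∸_; _≤_; _<_; _⊔_; _≤ᵇ_; ⌊_/2⌋; z≤n; s≤s; z<s)
open import Data.Nat.Properties renaming (_≟_ to _≟ⁿ_)
open import Algebra.Properties.CommutativeSemigroup +-commutativeSemigroup using (interchange)
open import Data.Nat.DivMod using (_%_; _/_; m≡m%n+[m/n]*n; m%n<n)
open import Data.Nat.Induction using (<-rec)
open import Data.Nat.ListAction using (sum)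
open import Data.Nat.Solver using (module +-*-Solver)
open import Data.Fin using (Fin; toℕ; fromℕ<) renaming (zero to fzero; suc to fsuc)
open import Data.Fin.Properties using (pigeonhole; toℕ-fromℕ<; toℕ-injective; toℕ<n; toℕ≤pred[n]) renaming (_≟_ to _≟ᶠ_)
open import Data.Bool using (Bool; true; false; if_then_else_; _∧_; not; T)
open import Data.Bool.Properties using (not-involutive) renaming (_≟_ to _≟ᵇ_)
open import Data.List using (List; []; _∷_; length; foldl; map; tabulate; allFin)
open import Data.List.Properties using (map-tabulate)
open import Data.List.Membership.Propositional using (_∈_)
open import Data.List.Membership.Propositional.Properties using (∈-allFin)
open import Data.List.Relation.Unary.All as All using (All; []; _∷_)
open import Data.List.Relation.Unary.AllPairs using ([]; _∷_)
open import Data.List.Relation.Unary.Any using (here; there)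
open import Data.List.Relation.Unary.Unique.Propositional using (Unique)
open import Data.List.Relation.Unary.Unique.Propositional.Properties using (allFin⁺)
open import Data.Product using (∃; _×_; _,_; proj₁; proj₂)
open import Data.Product.Properties using (≡-dec)
open import Data.Sum using (_⊎_; inj₁; inj₂)
open import Data.Empty using (⊥; ⊥-elim)
open import Function using (_∘_)
open import Relation.Nullary using (¬_; Dec; yes; no; does; contradiction)
open import Relation.Binary using (DecidableEquality)
open import Relation.Binary.PropositionalEquality using (_≡_; _≢_; refl; sym; trans; cong; cong₂; subst; ≢-sym; module ≡-Reasoning)

-- A rotation ρ is extended by the identity to all darts, and its faces
-- are the orbits of ρθ.  Inserting a dart d after a dart x replaces ρ by
-- ρ(x d), hence ρθ by ρθ(θx θd): multiplying a permutation by a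
-- transposition merges two orbits or splits one, so the effect of an
-- insertion on the number of faces is known exactly.
--
-- A deleted vertex v of odd degree is put back as follows.  Its first
-- edge is pendant and adds no face.  The other edges come in pairs: the
-- first edge of a pair either joins two faces, or it splits a face and
-- then v lies on both parts, at least one of which can be joined by the
-- second edge to another face.  So no pair increases the number of
-- faces, and the genus grows by (d(v) - 1)/2.
--
-- As ⌊_/2⌋ and ∸ in the definition of the genus truncate, the argument
-- needs |V| + |F| ≤ |E| + 2 for connected graphs.  It comes from
-- building ρθ out of ρ by one transposition per edge: an edge joining
-- two components of the graph formed so far has to merge two orbits.

-- Orbits are counted over all darts of G, present or not. An edge with neither dart inserted is a
-- 2-cycle of ρθ, so `faceCount` is the number of faces plus the number of absent edges. The first
-- transposition of an edge merges its 2-cycle into a face and costs one orbit; the second changes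
-- the count by one, up or down. Joining two faces thus lowers the total by 2, splitting a face
-- leaves it unchanged, and a pair of edges adds no face if the total falls by at least 2. This is
-- why the bounds read `faceCount ρ' + m ≤ faceCount ρ`, with m the number of edges inserted.
--
-- The far dart of a new edge is inserted after a dart already at that vertex. Independence puts
-- every neighbour of a deleted vertex into the smaller graph, and connectedness gives each vertex
-- there a dart, unless the graph is a single vertex without edges. In that case there is no dart to
-- start from and the only face is the default value in `faces`, so it is treated separately.

∧-elim : ∀ {x y} → x ∧ y ≡ true → x ≡ true × y ≡ true
∧-elim {true} eq = refl , eq

∧-intro : ∀ {x y} → x ≡ true → y ≡ true → x ∧ y ≡ true
∧-intro refl refl = refl

true≢false : ∀ {b} → b ≡ true → b ≡ false → ⊥
true≢false refl ()

-- Counting on finite types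

record Counting (X : Set) : Set where
  field
    -- Vertices and edges are counted by `count`, darts by the paired sum in `faces`. Finding an
    -- element of a nonempty set and removing one element are all that the cardinality arguments
    -- use, so both sums are instances.
    _≟_    : DecidableEquality X
    #      : (X → Bool) → ℕ
    #-find : ∀ P {m} → # P ≡ suc m → ∃ λ x → P x ≡ true
    #-drop : ∀ P Q x → P x ≡ true → Q x ≡ false → (∀ y → y ≢ x → P y ≡ Q y) →
             # P ≡ suc (# Q)

module _ {X : Set} (C : Counting X) where
  open Counting C

  _∖_ : (X → Bool) → X → X → Bool
  (P ∖ x) y = P y ∧ not (does (y ≟ x))

  ∖-elim : ∀ {P x y} → (P ∖ x) y ≡ true → P y ≡ true × y ≢ x
  ∖-elim {P} {x} {y} eq with ∧-elim {P y} eq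
  ... | p , q with y ≟ x
  ...   | no y≢x = p , y≢x

  ∖-intro : ∀ {P x y} → P y ≡ true → y ≢ x → (P ∖ x) y ≡ true
  ∖-intro {P} {x} {y} p y≢x with y ≟ x
  ... | yes y≡x = contradiction y≡x y≢x
  ... | no  _   = ∧-intro {P y} p refl

  ∖-# : ∀ P x → P x ≡ true → # P ≡ suc (# (P ∖ x))
  ∖-# P x px = #-drop P (P ∖ x) x px at-x off-x
    where
    at-x : (P ∖ x) x ≡ false
    at-x with P x | x ≟ x
    ... | true  | yes _ = refl
    ... | true  | no x≢x = contradiction refl x≢x
    ... | false | _ = refl
    off-x : ∀ y → y ≢ x → P y ≡ (P ∖ x) y
    off-x y y≢x with P y | y ≟ x
    ... | _     | yes y≡x = contradiction y≡x y≢x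
    ... | true  | no _ = refl
    ... | false | no _ = refl

module _ {X Y : Set} (CX : Counting X) (CY : Counting Y) where
  private
    module CX = Counting CX
    module CY = Counting CY

  #-injection : ∀ P Q (h : X → Y) → (∀ x → P x ≡ true → Q (h x) ≡ true) →
                (∀ x x' → P x ≡ true → P x' ≡ true → h x ≡ h x' → x ≡ x') →
                CX.# P ≤ CY.# Q
  #-injection P Q h hom inj = go _ P Q refl hom inj
    where
    go : ∀ m P Q → CX.# P ≡ m → (∀ x → P x ≡ true → Q (h x) ≡ true) →
         (∀ x x' → P x ≡ true → P x' ≡ true → h x ≡ h x' → x ≡ x') → CX.# P ≤ CY.# Q
    go zero    P Q eq hom inj = subst (_≤ _) (sym eq) z≤n
    go (suc m) P Q eq hom inj with CX.#-find P eq
    ... | x , px = begin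
      CX.# P                    ≡⟨ ∖-# CX P x px ⟩
      suc (CX.# P')             ≤⟨ s≤s (go m P' Q' (suc-injective (trans (sym (∖-# CX P x px)) eq))
                                       hom' λ y y' py py' → inj y y' (proj₁ (∖-elim CX {P} py)) (proj₁ (∖-elim CX {P} py'))) ⟩
      suc (CY.# Q')             ≡⟨ sym (∖-# CY Q (h x) (hom x px)) ⟩
      CY.# Q                    ∎
      where
      open ≤-Reasoning
      P' = _∖_ CX P x
      Q' = _∖_ CY Q (h x)
      hom' : ∀ y → P' y ≡ true → Q' (h y) ≡ true
      hom' y p'y with ∖-elim CX {P} p'y
      ... | py , y≢x = ∖-intro CY {Q} (hom y py) λ hy≡hx → y≢x (inj y x py px hy≡hx)

  #-injection-missing : ∀ P Q (h : X → Y) (z : Y) → (∀ x → P x ≡ true → Q (h x) ≡ true) →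
                (∀ x x' → P x ≡ true → P x' ≡ true → h x ≡ h x' → x ≡ x') →
                Q z ≡ true → (∀ x → P x ≡ true → h x ≢ z) →
                suc (CX.# P) ≤ CY.# Q
  #-injection-missing P Q h z hom inj qz miss = subst (suc (CX.# P) ≤_) (sym (∖-# CY Q z qz))
    (s≤s (#-injection P (_∖_ CY Q z) h (λ x px → ∖-intro CY {Q} (hom x px) (miss x px)) inj))

module _ {X : Set} (C : Counting X) where
  open Counting C

  #-mono : ∀ P Q → (∀ x → P x ≡ true → Q x ≡ true) → # P ≤ # Q
  #-mono P Q P⊆Q = #-injection C C P Q (λ x → x) P⊆Q (λ _ _ _ _ eq → eq)

  #-mono-except : ∀ P Q z → (∀ x → P x ≡ true → x ≢ z → Q x ≡ true) → # P ≤ suc (# Q)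
  #-mono-except P Q z h with P z in pz
  ... | true = subst (_≤ suc (# Q)) (sym (∖-# C P z pz)) (s≤s (#-mono _ _ λ x px' →
                 let px , x≢z = ∖-elim C {P} px' in h x px x≢z))
  ... | false = m≤n⇒m≤1+n (#-mono _ _ λ x px → h x px λ { refl → true≢false px pz })

  #-≤1 : ∀ P → (∀ x y → P x ≡ true → P y ≡ true → x ≡ y) → # P ≤ 1
  #-≤1 P unique with # P in eq
  ... | zero = z≤n
  ... | suc zero = ≤-refl
  ... | suc (suc m) with #-find P eq
  ...   | x , px with #-find (_∖_ C P x) (suc-injective (trans (sym (∖-# C P x px)) eq))
  ...     | y , py' = let py , y≢x = ∖-elim C {P} py' in contradiction (unique y x py px) y≢x

-- Permutations, iterates and multiplication by a transposition

record Perm (X : Set) : Set where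
  field
    to      : X → X
    from    : X → X
    to-from : ∀ x → to (from x) ≡ x
    from-to : ∀ x → from (to x) ≡ x

  to-injective : ∀ {x y} → to x ≡ to y → x ≡ y
  to-injective {x} {y} eq = trans (sym (from-to x)) (trans (cong from eq) (from-to y))

open Perm using (to)

module _ {X : Set} where

  iter-+ : ∀ (f : X → X) m k x → iter f (m + k) x ≡ iter f m (iter f k x)
  iter-+ f zero    k x = refl
  iter-+ f (suc m) k x = cong f (iter-+ f m k x)

  iter-fixed : ∀ (f : X → X) {p x} → iter f p x ≡ x → ∀ q → iter f (q * p) x ≡ x
  iter-fixed f eq zero = refl
  iter-fixed f {p} {x} eq (suc q) = trans (iter-+ f p (q * p) x) (trans (cong (iter f p) (iter-fixed f eq q)) eq)

  iter-cong : ∀ {f g : X → X} → (∀ x → f x ≡ g x) → ∀ k x → iter f k x ≡ iter g k x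
  iter-cong f≗g zero    x = refl
  iter-cong {f} {g} f≗g (suc k) x = trans (f≗g _) (cong g (iter-cong f≗g k x))

  iter-injective : (σ : Perm X) → ∀ k {x y} → iter (to σ) k x ≡ iter (to σ) k y → x ≡ y
  iter-injective σ zero    eq = eq
  iter-injective σ (suc k) eq = iter-injective σ k (Perm.to-injective σ eq)

  -- This is `g = f ∘ (a b)`, stated through values: it then fits ρ, ρθ and the intermediate
  -- products alike, and it is symmetric in `f` and `g`.
  record Transposed (f g : X → X) (a b : X) : Set where
    field
      at-a : g a ≡ f b
      at-b : g b ≡ f a
      off  : ∀ x → x ≢ a → x ≢ b → g x ≡ f x

  flip-transposed : ∀ {f g a b} → Transposed f g a b → Transposed g f a b
  flip-transposed t = record
    { at-a = sym at-b ; at-b = sym at-a ; off = λ x x≢a x≢b → sym (off x x≢a x≢b) }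
    where open Transposed t

-- Bounded search

allBelow-elim : ∀ N p → allBelow N p ≡ true → ∀ {k} → k < N → p k ≡ true
allBelow-elim (suc N) p eq {k} (s≤s k≤N) with ∧-elim {allBelow N p} eq
... | below , top with k ≟ⁿ N
...   | yes refl = top
...   | no k≢N = allBelow-elim N p below (≤∧≢⇒< k≤N k≢N)

allBelow-intro : ∀ N p → (∀ {k} → k < N → p k ≡ true) → allBelow N p ≡ true
allBelow-intro zero    p h = refl
allBelow-intro (suc N) p h = ∧-intro (allBelow-intro N p (h ∘ m<n⇒m<1+n)) (h ≤-refl)

allBelow-fails : ∀ N p → allBelow N p ≡ false → ∃ λ k → p k ≡ false
allBelow-fails (suc N) p eq with allBelow N p in below
... | true  = N , eq
... | false = allBelow-fails N p below

allBelow-cong : ∀ N {p q} → (∀ k → p k ≡ q k) → allBelow N p ≡ allBelow N q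
allBelow-cong zero    h = refl
allBelow-cong (suc N) h = cong₂ _∧_ (allBelow-cong N h) (h N)

≤ᵇ-true : ∀ {m n} → m ≤ n → (m ≤ᵇ n) ≡ true
≤ᵇ-true {m} {n} m≤n with m ≤ᵇ n | ≤⇒≤ᵇ m≤n
... | true | _ = refl

≤ᵇ-true⁻¹ : ∀ {m n} → (m ≤ᵇ n) ≡ true → m ≤ n
≤ᵇ-true⁻¹ {m} {n} eq = ≤ᵇ⇒≤ m n (subst T (sym eq) _)

≤ᵇ-false⁻¹ : ∀ {m n} → (m ≤ᵇ n) ≡ false → n < m
≤ᵇ-false⁻¹ eq = ≰⇒> λ m≤n → true≢false (≤ᵇ-true m≤n) eq

least : ∀ {P : ℕ → Set} → (∀ k → Dec (P k)) → ∀ k → P k → ∃ λ m → P m × (∀ j → j < m → ¬ P j)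
least {P} P? = <-rec _ search
  where
  search : ∀ k → (∀ {j} → j < k → P j → ∃ λ m → P m × (∀ j → j < m → ¬ P j)) →
           P k → ∃ λ m → P m × (∀ j → j < m → ¬ P j)
  search k rec pk with anyUpTo? P? k
  ... | yes (j , j<k , pj) = rec j<k pj
  ... | no  none = k , pk , λ j j<k pj → none (j , j<k , pj)

-- Orbits of permutations of a finite set

module Orbits {X : Set} (C : Counting X) (key : X → ℕ) (key-injective : ∀ {x y} → key x ≡ key y → x ≡ y)
              (n : ℕ) (key<n : ∀ x → key x < n) where
  open Counting C renaming (_≟_ to _≟ˣ_)

  infix 4 _⊢_~_
  _⊢_~_ : (X → X) → X → X → Set
  f ⊢ x ~ y = ∃ λ k → iter f k x ≡ y

  -- The same bounded test as in `isRep`, so that faces are literally counted by `orbits`. That `n`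
  -- steps see the whole orbit is `~-bounded`.
  minRep : (X → X) → X → Bool
  minRep f x = allBelow (suc n) (λ k → key x ≤ᵇ key (iter f k x))

  orbits : (X → X) → ℕ
  orbits f = # (minRep f)

  orbits-cong : ∀ {f g} → (∀ x → f x ≡ g x) → orbits f ≤ orbits g
  orbits-cong f≗g = #-mono C _ _ λ x → trans (allBelow-cong (suc n) λ k →
    cong (λ y → key x ≤ᵇ key y) (sym (iter-cong f≗g k x)))

  ~-refl : ∀ {f x} → f ⊢ x ~ x
  ~-refl = 0 , refl

  ~-step : ∀ {f x} → f ⊢ x ~ f x
  ~-step = 1 , refl

  ~-trans : ∀ {f x y z} → f ⊢ x ~ y → f ⊢ y ~ z → f ⊢ x ~ z
  ~-trans {f} {x} (k , p) (l , q) = l + k , trans (iter-+ f l k x) (trans (cong (iter f l) p) q)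

  ~-extend : ∀ {f x y} → f ⊢ x ~ y → f ⊢ x ~ f y
  ~-extend {f} (k , p) = suc k , cong f p

  ~-invariant : ∀ {f} (P : X → Set) → (∀ {x} → P x → P (f x)) → ∀ {x y} → f ⊢ x ~ y → P x → P y
  ~-invariant {f} P step (k , p) px = subst P p (go k)
    where
    go : ∀ k → P (iter f k _)
    go zero    = px
    go (suc k) = step (go k)

  module _ (σ : Perm X) where
    private f = to σ

    -- Of the first `n + 1` iterates two share a key, by pigeonhole; injectivity of `f` cancels the
    -- earlier one and leaves a return to `x`.
    period : ∀ x → ∃ λ p → iter f (suc p) x ≡ x × suc p ≤ n
    period x with pigeonhole (n<1+n n) (λ (i : Fin (suc n)) → fromℕ< (key<n (iter f (toℕ i) x)))
    ... | i , j , i<j , eq = p , fixed , bound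
      where
      p = toℕ j ∸ suc (toℕ i)
      suc-p : suc p + toℕ i ≡ toℕ j
      suc-p = trans (sym (+-suc p (toℕ i))) (m∸n+n≡m i<j)
      same : iter f (toℕ i) x ≡ iter f (toℕ j) x
      same = key-injective (trans (sym (toℕ-fromℕ< (key<n _))) (trans (cong toℕ eq) (toℕ-fromℕ< (key<n _))))
      fixed : iter f (suc p) x ≡ x
      fixed = iter-injective σ (toℕ i) (begin
        iter f (toℕ i) (iter f (suc p) x) ≡⟨ iter-+ f (toℕ i) (suc p) x ⟨
        iter f (toℕ i + suc p) x          ≡⟨ cong (λ k → iter f k x) (trans (+-comm (toℕ i) (suc p)) suc-p) ⟩
        iter f (toℕ j) x                  ≡⟨ same ⟨
        iter f (toℕ i) x                  ∎)
        where open ≡-Reasoning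
      bound : suc p ≤ n
      bound = ≤-trans (m≤m+n (suc p) (toℕ i)) (subst (_≤ n) (sym suc-p) (toℕ≤pred[n] j))

    ~-sym : ∀ {x y} → f ⊢ x ~ y → f ⊢ y ~ x
    ~-sym {x} (k , refl) with period x
    -- `k` steps are undone by `k * p` further ones, since `k + k * p` is a multiple of the period
    -- `suc p`.
    ... | p , fixed , _ = k * p , trans (sym (iter-+ f (k * p) k x))
        (trans (cong (λ m → iter f m x) (trans (+-comm (k * p) k) (sym (*-suc k p)))) (iter-fixed f fixed k))

    ~-bounded : ∀ {x y} → f ⊢ x ~ y → ∃ λ k → k ≤ n × iter f k x ≡ y
    ~-bounded {x} (k , refl) with period x
    ... | p , fixed , p≤n = k % suc p , ≤-trans (<⇒≤ (m%n<n k (suc p))) p≤n , (begin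
        iter f (k % suc p) x                                       ≡⟨ cong (iter f (k % suc p)) (iter-fixed f fixed (k / suc p)) ⟨
        iter f (k % suc p) (iter f (k / suc p * suc p) x)          ≡⟨ iter-+ f (k % suc p) (k / suc p * suc p) x ⟨
        iter f (k % suc p + k / suc p * suc p) x                   ≡⟨ cong (λ m → iter f m x) (m≡m%n+[m/n]*n k (suc p)) ⟨
        iter f k x                                                 ∎)
        where open ≡-Reasoning

    minRep-≤ : ∀ {x y} → minRep f x ≡ true → f ⊢ x ~ y → key x ≤ key y
    minRep-≤ {x} mx x~y with ~-bounded x~y
    ... | k , k≤n , refl = ≤ᵇ-true⁻¹ (allBelow-elim (suc n) _ mx (s≤s k≤n))

    minRep-unique : ∀ {x y} → minRep f x ≡ true → minRep f y ≡ true → f ⊢ x ~ y → x ≡ y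
    minRep-unique mx my x~y = key-injective (≤-antisym (minRep-≤ mx x~y) (minRep-≤ my (~-sym x~y)))

    Representative : X → Set
    Representative x = ∃ λ y → minRep f y ≡ true × f ⊢ x ~ y

    representative : ∀ x → Representative x
    representative x = <-rec (λ m → ∀ x → key x ≡ m → Representative x) descend (key x) x refl
      where
      descend : ∀ m → (∀ {l} → l < m → ∀ x → key x ≡ l → Representative x) → ∀ x → key x ≡ m → Representative x
      descend m rec x refl with minRep f x in eq
      ... | true  = x , eq , ~-refl
      ... | false with allBelow-fails (suc n) _ eq
      ...   | k , smaller with rec (≤ᵇ-false⁻¹ smaller) (iter f k x) refl
      ...     | y , my , x~y = y , my , ~-trans (k , refl) x~y

    rep : X → X
    rep x = proj₁ (representative x)

    rep-min : ∀ x → minRep f (rep x) ≡ true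
    rep-min x = proj₁ (proj₂ (representative x))

    ~-rep : ∀ x → f ⊢ x ~ rep x
    ~-rep x = proj₂ (proj₂ (representative x))

    rep-≡⇒~ : ∀ {x y} → rep x ≡ rep y → f ⊢ x ~ y
    rep-≡⇒~ {x} {y} eq = ~-trans (~-rep x) (subst (λ z → f ⊢ z ~ y) (sym eq) (~-sym (~-rep y)))

    ~⇒rep-≡ : ∀ {x y} → f ⊢ x ~ y → rep x ≡ rep y
    ~⇒rep-≡ {x} {y} x~y = minRep-unique (rep-min x) (rep-min y) (~-trans (~-sym (~-rep x)) (~-trans x~y (~-rep y)))

    ~-dec : ∀ x y → Dec (f ⊢ x ~ y)
    ~-dec x y with rep x ≟ˣ rep y
    ... | yes eq = yes (rep-≡⇒~ eq)
    ... | no neq = no (neq ∘ ~⇒rep-≡)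

  module _ (σ τ : Perm X) {a b : X} (t : Transposed (to σ) (to τ) a b) where
    private
      f = to σ
      g = to τ
    open Transposed t

    -- The equivalence obtained by gluing the `f`-orbits of `a` and `b`. A step of `g` is a step of
    -- `f` up to exchanging `a` and `b`, so it stays within a class, whether the transposition
    -- merges or splits.
    Joined : X → X → Set
    Joined y z = f ⊢ y ~ z ⊎ (f ⊢ y ~ a × f ⊢ b ~ z) ⊎ (f ⊢ y ~ b × f ⊢ a ~ z)

    transposed-⊆ : ∀ {y z} → g ⊢ y ~ z → Joined y z
    transposed-⊆ y~z = ~-invariant (Joined _) extend y~z (inj₁ ~-refl)
      where
      splitA : ∀ {y} → Joined y a → f ⊢ y ~ a ⊎ f ⊢ y ~ b
      splitA (inj₁ p) = inj₁ p
      splitA (inj₂ (inj₁ (p , _))) = inj₁ p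
      splitA (inj₂ (inj₂ (p , _))) = inj₂ p
      splitB : ∀ {y} → Joined y b → f ⊢ y ~ a ⊎ f ⊢ y ~ b
      splitB (inj₁ p) = inj₂ p
      splitB (inj₂ (inj₁ (p , _))) = inj₁ p
      splitB (inj₂ (inj₂ (p , _))) = inj₂ p
      extend : ∀ {y w} → Joined y w → Joined y (g w)
      extend {y} {w} j with w ≟ˣ a
      ... | yes refl rewrite at-a with splitA j
      ...   | inj₁ p = inj₂ (inj₁ (p , ~-step))
      ...   | inj₂ p = inj₁ (~-extend p)
      extend {y} {w} j | no w≢a with w ≟ˣ b
      ... | yes refl rewrite at-b with splitB j
      ...   | inj₁ p = inj₁ (~-extend p)
      ...   | inj₂ p = inj₂ (inj₂ (p , ~-step))
      extend {y} {w} j | no w≢a | no w≢b rewrite off w w≢a w≢b with j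
      ... | inj₁ p = inj₁ (~-extend p)
      ... | inj₂ (inj₁ (p , q)) = inj₂ (inj₁ (p , ~-extend q))
      ... | inj₂ (inj₂ (p , q)) = inj₂ (inj₂ (p , ~-extend q))

    -- From `a`, `g` jumps to `f b` and then agrees with `f` along the orbit of `b`, which avoids
    -- `a`, until it arrives at `b`.
    merged : ¬ f ⊢ a ~ b → g ⊢ a ~ b
    merged a≁b with period σ b
    ... | p , fixed , _ = finish (follow p)
      where
      follow : ∀ k → g ⊢ a ~ iter f (suc k) b ⊎ g ⊢ a ~ b
      follow zero = inj₁ (1 , at-a)
      follow (suc k) with follow k
      ... | inj₂ done = inj₂ done
      ... | inj₁ p with iter f (suc k) b ≟ˣ b
      ...   | yes eq = inj₂ (subst (g ⊢ a ~_) eq p)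
      ...   | no ≢b = inj₁ (subst (g ⊢ a ~_) (off _ (λ eq → a≁b (~-sym σ (suc k , eq))) ≢b) (~-extend p))
      finish : g ⊢ a ~ iter f (suc p) b ⊎ g ⊢ a ~ b → g ⊢ a ~ b
      finish (inj₁ q) = subst (g ⊢ a ~_) fixed q
      finish (inj₂ q) = q

    separated : a ≢ b → f ⊢ a ~ b → ¬ g ⊢ a ~ b
    separated a≢b a~b a~'b with ~-sym σ a~b
    ... | zero  , eq = a≢b (sym eq)
    ... | suc l , eq with least (λ k → iter f (suc k) b ≟ˣ a) l eq
    ...   | k , arrive , first = not-arc-b (~-invariant Arc closed a~'b (k , ≤-refl , sym arrive))
      where
      -- The stretch f b, f² b, …, a of the f-orbit closes up under g.
      Arc : X → Set
      Arc x = ∃ λ i → i ≤ k × x ≡ iter f (suc i) b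
      avoids-b : ∀ {i} → i < k → iter f (suc i) b ≢ b
      -- A return to `b` after `suc i` steps would let `a` be reached from `b` after only
      -- `suc (k ∸ suc i)` steps, against the minimality of `k`.
      avoids-b {i} i<k eq = first (k ∸ suc i) (∸-monoʳ-< z<s i<k) (begin
        iter f (suc (k ∸ suc i)) b                        ≡⟨ cong (λ m → iter f m b) (sym (+-∸-assoc 1 i<k)) ⟩
        iter f (k ∸ i) b                                  ≡⟨ cong (iter f (k ∸ i)) eq ⟨
        iter f (k ∸ i) (iter f (suc i) b)                 ≡⟨ iter-+ f (k ∸ i) (suc i) b ⟨
        iter f (k ∸ i + suc i) b                          ≡⟨ cong (λ m → iter f m b) (trans (+-suc (k ∸ i) i) (cong suc (m∸n+n≡m (<⇒≤ i<k)))) ⟩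
        iter f (suc k) b                                  ≡⟨ arrive ⟩
        a ∎)
        where open ≡-Reasoning
      closed : ∀ {x} → Arc x → Arc (g x)
      closed (i , i≤k , refl) with m≤n⇒m<n∨m≡n i≤k
      ... | inj₂ refl = 0 , z≤n , trans (cong g arrive) at-a
      ... | inj₁ i<k = suc i , i<k , off _ (first i i<k) (avoids-b i<k)
      not-arc-b : ¬ Arc b
      not-arc-b (i , i≤k , eq) with m≤n⇒m<n∨m≡n i≤k
      ... | inj₁ i<k = avoids-b i<k (sym eq)
      ... | inj₂ refl = a≢b (trans (sym arrive) (sym eq))

  module _ (σ τ : Perm X) {a b : X} (t : Transposed (to σ) (to τ) a b) where
    private
      f = to σ
      g = to τ
      f⊆g : ∀ {y z} → f ⊢ y ~ z → Joined τ σ (flip-transposed t) y z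
      f⊆g = transposed-⊆ τ σ (flip-transposed t)

    merged-coarser : ¬ f ⊢ a ~ b → ∀ {y z} → f ⊢ y ~ z → g ⊢ y ~ z
    merged-coarser a≁b y~z with f⊆g y~z | merged σ τ t a≁b
    ... | inj₁ p              | _     = p
    ... | inj₂ (inj₁ (p , q)) | a~'b = ~-trans p (~-trans a~'b q)
    ... | inj₂ (inj₂ (p , q)) | a~'b = ~-trans p (~-trans (~-sym τ a~'b) q)

    -- Two `g`-representatives in one `f`-orbit are `g`-equivalent, or one of them lies in the
    -- `g`-orbit of `b`. Once the representative of that orbit is discarded, `rep σ` is injective on
    -- the others.
    orbits-transposed : orbits g ≤ suc (orbits f)
    orbits-transposed = subst (_≤ suc (orbits f)) (sym (∖-# C (minRep g) (rep τ b) (rep-min τ b)))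
      (s≤s (#-injection C C _ _ (rep σ) (λ x _ → rep-min σ x) λ x y px py eq → inj px py (f⊆g (rep-≡⇒~ σ eq))))
      where
      not-rep-b : ∀ {y} → (C ∖ minRep g) (rep τ b) y ≡ true → ¬ g ⊢ b ~ y
      not-rep-b {y} py b~y with ∖-elim C {minRep g} py
      ... | my , y≢rb = y≢rb (minRep-unique τ my (rep-min τ b) (~-trans (~-sym τ b~y) (~-rep τ b)))
      inj : ∀ {x y} → (C ∖ minRep g) (rep τ b) x ≡ true → (C ∖ minRep g) (rep τ b) y ≡ true →
            Joined τ σ (flip-transposed t) x y → x ≡ y
      inj px py (inj₁ x~y) = minRep-unique τ (proj₁ (∖-elim C {minRep g} px)) (proj₁ (∖-elim C {minRep g} py)) x~y
      inj px py (inj₂ (inj₁ (_ , b~y))) = contradiction b~y (not-rep-b py)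
      inj px py (inj₂ (inj₂ (x~b , _))) = contradiction (~-sym τ x~b) (not-rep-b px)

    -- As `g` is coarser, `rep σ` is injective on `g`-representatives. The merged orbit has a single
    -- one, `c`, but contains the `f`-orbits of `a` and `b`; whichever of these two does not contain
    -- `c` is missed.
    orbits-merged : ¬ f ⊢ a ~ b → suc (orbits g) ≤ orbits f
    orbits-merged a≁b = #-injection-missing C C _ _ (rep σ) (proj₁ missed) (λ x _ → rep-min σ x)
        (λ x y mx my eq → minRep-unique τ mx my (coarser (rep-≡⇒~ σ eq)))
        (proj₁ (proj₂ missed)) (proj₂ (proj₂ missed))
      where
      a~'b = merged σ τ t a≁b
      coarser : ∀ {y z} → f ⊢ y ~ z → g ⊢ y ~ z
      coarser = merged-coarser a≁b
      c = rep τ a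
      only-c : ∀ {y} → minRep g y ≡ true → g ⊢ y ~ a → y ≡ c
      only-c my y~a = minRep-unique τ my (rep-min τ a) (~-trans y~a (~-rep τ a))
      missed : ∃ λ z → minRep f z ≡ true × (∀ y → minRep g y ≡ true → rep σ y ≢ z)
      missed with rep σ c ≟ˣ rep σ a
      ... | yes eq = rep σ b , rep-min σ b , λ y my ry≡rb →
              a≁b (rep-≡⇒~ σ (trans (sym eq) (trans (cong (rep σ) (sym (only-c my
                (~-trans (coarser (rep-≡⇒~ σ ry≡rb)) (~-sym τ a~'b))))) ry≡rb)))
      ... | no neq = rep σ a , rep-min σ a , λ y my ry≡ra →
              neq (trans (cong (rep σ) (sym (only-c my (coarser (rep-≡⇒~ σ ry≡ra))))) ry≡ra)

-- Transpositions and duplicate-free enumerations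

module _ {X : Set} (C : Counting X) where
  open Counting C

  swap : X → X → X → X
  swap a b x = if does (x ≟ a) then b else if does (x ≟ b) then a else x

  swap-left : ∀ a b → swap a b a ≡ b
  swap-left a b with a ≟ a
  ... | yes _ = refl
  ... | no a≢a = contradiction refl a≢a

  swap-right : ∀ a b → swap a b b ≡ a
  swap-right a b with b ≟ a
  ... | yes b≡a = b≡a
  ... | no _ with b ≟ b
  ...   | yes _ = refl
  ...   | no b≢b = contradiction refl b≢b

  swap-other : ∀ {a b x} → x ≢ a → x ≢ b → swap a b x ≡ x
  swap-other {a} {b} {x} x≢a x≢b with x ≟ a
  ... | yes eq = contradiction eq x≢a
  ... | no _ with x ≟ b
  ...   | yes eq = contradiction eq x≢b
  ...   | no _ = refl

  swap-involutive : ∀ a b x → swap a b (swap a b x) ≡ x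
  swap-involutive a b x with x ≟ a
  ... | yes refl = swap-right a b
  ... | no x≢a with x ≟ b
  ...   | yes refl = swap-left a b
  ...   | no x≢b = swap-other x≢a x≢b

  transposition : X → X → Perm X
  transposition a b = record
    { to = swap a b ; from = swap a b ; to-from = swap-involutive a b ; from-to = swap-involutive a b }

  record Enumeration (P : X → Bool) : Set where
    field
      list     : List X
      size     : length list ≡ # P
      unique   : Unique list
      sound    : ∀ {x} → x ∈ list → P x ≡ true
      complete : ∀ {x} → P x ≡ true → x ∈ list

  enumerate : ∀ P → Enumeration P
  enumerate P = go (# P) P refl
    where
    go : ∀ m P → # P ≡ m → Enumeration P
    go zero P eq = record
      { list = [] ; size = sym eq ; unique = [] ; sound = λ () ; complete = λ {x} px →
        contradiction (trans (sym eq) (∖-# C P x px)) λ () }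
    go (suc m) P eq with #-find P eq
    ... | x , px with go m (_∖_ C P x) (suc-injective (trans (sym (∖-# C P x px)) eq))
    ...   | rest = record
      { list = x ∷ list
      ; size = trans (cong suc size) (sym (∖-# C P x px))
      ; unique = All.tabulate (λ y∈ → ≢-sym (proj₂ (∖-elim C {P} (sound y∈)))) ∷ unique
      ; sound = λ { (here refl) → px ; (there y∈) → proj₁ (∖-elim C {P} (sound y∈)) }
      ; complete = λ {y} py → found y py
      }
      where
      open Enumeration rest
      found : ∀ y → P y ≡ true → y ∈ x ∷ list
      found y py with y ≟ x
      ... | yes refl = here refl
      ... | no y≢x = there (complete (∖-intro C {P} py y≢x))

-- Finite sums; vertices, edges and darts as counted types

bit : Bool → ℕ
bit b = if b then 1 else 0

sumFin-cong : ∀ {k} {f g : Fin k → ℕ} → (∀ i → f i ≡ g i) → sumFin f ≡ sumFin g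
sumFin-cong {zero}  f≗g = refl
sumFin-cong {suc k} f≗g = cong₂ _+_ (f≗g fzero) (sumFin-cong (f≗g ∘ fsuc))

sumFin-+ : ∀ {k} (f g : Fin k → ℕ) → sumFin (λ i → f i + g i) ≡ sumFin f + sumFin g
sumFin-+ {zero}  f g = refl
sumFin-+ {suc k} f g = trans (cong (f fzero + g fzero +_) (sumFin-+ (f ∘ fsuc) (g ∘ fsuc)))
                             (interchange (f fzero) (g fzero) _ _)

sumFin-zero : ∀ k → sumFin {k} (λ _ → 0) ≡ 0
sumFin-zero zero    = refl
sumFin-zero (suc k) = sumFin-zero k

sumFin-bump : ∀ {k} (f g : Fin k → ℕ) i → f i ≡ suc (g i) → (∀ j → j ≢ i → f j ≡ g j) →
              sumFin f ≡ suc (sumFin g)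
sumFin-bump f g fzero    at off = cong₂ _+_ at (sumFin-cong λ j → off (fsuc j) λ ())
sumFin-bump f g (fsuc i) at off =
  trans (cong₂ _+_ (off fzero λ ()) (sumFin-bump (f ∘ fsuc) (g ∘ fsuc) i at λ j j≢i → off (fsuc j) λ { refl → j≢i refl }))
        (+-suc (g fzero) _)

sumFin-find : ∀ {k} (f : Fin k → ℕ) {m} → sumFin f ≡ suc m → ∃ λ i → ∃ λ l → f i ≡ suc l
sumFin-find {suc k} f eq with f fzero in f0
... | suc l = fzero , l , f0
... | zero with sumFin-find (f ∘ fsuc) eq
...   | i , l , fi = fsuc i , l , fi

bit-true : ∀ {b l} → bit b ≡ suc l → b ≡ true
bit-true {true} _ = refl

finCounting : ∀ n → Counting (Fin n)
finCounting n = record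
  { _≟_ = _≟ᶠ_
  ; # = count
  ; #-find = λ P eq → let i , _ , pi = sumFin-find (bit ∘ P) eq in i , bit-true pi
  ; #-drop = λ P Q x px qx off → sumFin-bump (bit ∘ P) (bit ∘ Q) x
      (trans (cong bit px) (cong (suc ∘ bit) (sym qx))) λ j j≢x → cong bit (off j j≢x)
  }

count-complement : ∀ {n} (P : Fin n → Bool) → count P + count (not ∘ P) ≡ n
count-complement {n} P = trans (sym (sumFin-+ (bit ∘ P) (bit ∘ not ∘ P))) (trans (sumFin-cong one) (ones n))
  where
  one : ∀ i → bit (P i) + bit (not (P i)) ≡ 1
  one i with P i
  ... | true  = refl
  ... | false = refl
  ones : ∀ n → sumFin {n} (λ _ → 1) ≡ n
  ones zero    = refl
  ones (suc n) = cong suc (ones n)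

-- Counting edge by edge, the two darts of an edge together, reproduces the sum in `faces`
-- definitionally.
dartCounting : (G : Graph) → Counting (Dart G)
dartCounting G = record
  { _≟_ = ≡-dec _≟ᶠ_ _≟ᵇ_
  ; # = λ P → sumFin (pair P)
  ; #-find = find
  ; #-drop = drop
  }
  where
  pair : (Dart G → Bool) → Fin (Graph.nE G) → ℕ
  pair P e = bit (P (e , false)) + bit (P (e , true))
  find : ∀ P {m} → sumFin (pair P) ≡ suc m → ∃ λ d → P d ≡ true
  find P eq with sumFin-find (pair P) eq
  ... | e , l , pe with P (e , false) in pf | P (e , true) in pt
  ...   | true  | _    = (e , false) , pf
  ...   | false | true = (e , true) , pt
  drop : ∀ P Q x → P x ≡ true → Q x ≡ false → (∀ y → y ≢ x → P y ≡ Q y) →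
         sumFin (pair P) ≡ suc (sumFin (pair Q))
  drop P Q (e , b) px qx off = sumFin-bump (pair P) (pair Q) e (at b px qx off) λ e' e'≢e →
      cong₂ (λ x y → bit x + bit y) (off _ (e'≢e ∘ cong proj₁)) (off _ (e'≢e ∘ cong proj₁))
    where
    at : ∀ b → P (e , b) ≡ true → Q (e , b) ≡ false → (∀ y → y ≢ (e , b) → P y ≡ Q y) →
         pair P e ≡ suc (pair Q e)
    at false px qx off rewrite px | qx = cong (suc ∘ bit) (off (e , true) λ ())
    at true  px qx off rewrite px | qx | off (e , false) (λ ()) = +-suc _ 0

_⊙_ : ∀ {X} → Perm X → Perm X → Perm X
σ ⊙ τ = record
  { to = to σ ∘ to τ
  ; from = Perm.from τ ∘ Perm.from σ
  ; to-from = λ x → trans (cong (to σ) (Perm.to-from τ _)) (Perm.to-from σ x)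
  ; from-to = λ x → trans (cong (Perm.from τ) (Perm.from-to σ _)) (Perm.from-to τ x)
  }

swap-transposed : ∀ {X} (C : Counting X) (ρ : Perm X) a b → Transposed (to ρ) (to (ρ ⊙ transposition C a b)) a b
swap-transposed C ρ a b = record
  { at-a = cong (to ρ) (swap-left C a b)
  ; at-b = cong (to ρ) (swap-right C a b)
  ; off = λ x x≢a x≢b → cong (to ρ) (swap-other C x≢a x≢b)
  }

sumFin-single : ∀ {k} (f : Fin k → ℕ) i → (∀ j → j ≢ i → f j ≡ 0) → sumFin f ≡ f i
sumFin-single {suc k} f fzero    off = trans (cong (f fzero +_) (trans (sumFin-cong λ j → off (fsuc j) λ ()) (sumFin-zero k)))
                                             (+-identityʳ _)
sumFin-single f (fsuc i) off = cong₂ _+_ (off fzero λ ())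
  (sumFin-single (f ∘ fsuc) i λ j j≢i → off (fsuc j) (λ { refl → j≢i refl }))

sumFin-exchange : ∀ {k l} (h : Fin k → Fin l → ℕ) → sumFin (λ i → sumFin (h i)) ≡ sumFin (λ j → sumFin λ i → h i j)
sumFin-exchange {zero}  {l} h = sym (sumFin-zero l)
sumFin-exchange {suc k} h = trans (cong (sumFin (h fzero) +_) (sumFin-exchange (h ∘ fsuc)))
  (sym (sumFin-+ (h fzero) _))

sumFin-even : ∀ {k} (f : Fin k → ℕ) → (∀ i → ∃ λ h → f i ≡ 2 * h) → ∃ λ h → sumFin f ≡ 2 * h
sumFin-even {zero}  f even = 0 , refl
sumFin-even {suc k} f even with even fzero | sumFin-even (f ∘ fsuc) (even ∘ fsuc)
... | h , eq | h' , eq' = h + h' , trans (cong₂ _+_ eq eq') (sym (*-distribˡ-+ 2 h h'))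

sum-tabulate : ∀ {k} (f : Fin k → ℕ) → sum (tabulate f) ≡ sumFin f
sum-tabulate {zero}  f = refl
sum-tabulate {suc k} f = cong (f fzero +_) (sum-tabulate (f ∘ fsuc))

nonempty : ∀ {X : Set} {xs : List X} {n} → length xs ≡ suc n → ∃ (_∈ xs)
nonempty {xs = x ∷ _} _ = x , here refl

⌊n+2*h/2⌋ : ∀ n h → ⌊ n + 2 * h /2⌋ ≡ ⌊ n /2⌋ + h
⌊n+2*h/2⌋ n zero = trans (cong ⌊_/2⌋ (+-identityʳ n)) (sym (+-identityʳ _))
⌊n+2*h/2⌋ n (suc h) = begin
  ⌊ n + 2 * suc h /2⌋         ≡⟨ cong ⌊_/2⌋ (solve 2 (λ n h → n :+ con 2 :* (con 1 :+ h) := con 2 :+ (n :+ con 2 :* h)) refl n h) ⟩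
  suc ⌊ n + 2 * h /2⌋         ≡⟨ cong suc (⌊n+2*h/2⌋ n h) ⟩
  suc (⌊ n /2⌋ + h)           ≡⟨ sym (+-suc _ h) ⟩
  ⌊ n /2⌋ + suc h             ∎
  where
  open ≡-Reasoning
  open +-*-Solver

-- Faces as orbits on all darts

module Surface (G : Graph) where
  open Graph G

  private
    𝔻 = Dart G
    θᴳ : 𝔻 → 𝔻
    θᴳ = θ G
    vertᴳ : 𝔻 → Fin nV
    vertᴳ = vert G
    darts = dartCounting G
    sw : 𝔻 → 𝔻 → 𝔻 → 𝔻
    sw = swap darts
    tr : 𝔻 → 𝔻 → Perm 𝔻
    tr = transposition darts

  θ-involutive : ∀ d → θᴳ (θᴳ d) ≡ d
  θ-involutive (e , b) = cong (e ,_) (not-involutive b)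

  key-injective : ∀ {d d'} → key G d ≡ key G d' → d ≡ d'
  key-injective {e , false} {e' , false} eq = cong (_, false) (toℕ-injective (*-cancelˡ-≡ (toℕ e) (toℕ e') 2 (+-cancelʳ-≡ 0 _ _ eq)))
  key-injective {e , true}  {e' , true}  eq = cong (_, true) (toℕ-injective (*-cancelˡ-≡ (toℕ e) (toℕ e') 2 (+-cancelʳ-≡ 1 _ _ eq)))
  key-injective {e , false} {e' , true}  eq = contradiction (trans (sym (+-identityʳ _)) (trans eq (+-comm _ 1))) (even≢odd (toℕ e) (toℕ e'))
  key-injective {e , true}  {e' , false} eq = contradiction (trans (sym (+-identityʳ _)) (trans (sym eq) (+-comm _ 1))) (even≢odd (toℕ e') (toℕ e))

  key<nDarts : ∀ d → key G d < nDarts G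
  key<nDarts (e , b) = begin-strict
    2 * toℕ e + bit b   <⟨ +-monoʳ-< (2 * toℕ e) (bit<2 b) ⟩
    2 * toℕ e + 2       ≡⟨ trans (+-comm (2 * toℕ e) 2) (sym (*-suc 2 (toℕ e))) ⟩
    2 * suc (toℕ e)     ≤⟨ *-monoʳ-≤ 2 (toℕ<n e) ⟩
    2 * nE              ∎
    where
    open ≤-Reasoning
    bit<2 : ∀ b → bit b < 2
    bit<2 false = s≤s z≤n
    bit<2 true  = s≤s (s≤s z≤n)

  open Counting darts public renaming (_≟_ to _≟ᵈ_)
  open Orbits darts (key G) key-injective (nDarts G) key<nDarts public

  -- θ restricted to the edges in `q`. It interpolates between the identity and θ, and admitting one
  -- more edge multiplies by the transposition of its two darts.
  flipOn : (Fin nE → Bool) → Perm 𝔻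
  flipOn q = record { to = flip ; from = flip ; to-from = involutive ; from-to = involutive }
    where
    flip : 𝔻 → 𝔻
    flip d = if q (proj₁ d) then θᴳ d else d
    involutive : ∀ d → flip (flip d) ≡ d
    involutive d with q (proj₁ d) in eq
    ... | false rewrite eq = refl
    ... | true  rewrite eq = θ-involutive d

  θ-perm : Perm 𝔻
  θ-perm = flipOn λ _ → true

  flipOn-true : ∀ q {d} → q (proj₁ d) ≡ true → to (flipOn q) d ≡ θᴳ d
  flipOn-true q eq rewrite eq = refl

  flipOn-false : ∀ q {d} → q (proj₁ d) ≡ false → to (flipOn q) d ≡ d
  flipOn-false q eq rewrite eq = refl

  module _ (S : VSet G) where

    inS : 𝔻 → Bool
    inS d = edgeInᵇ G S (proj₁ d)

    vert-inside : ∀ d → DartIn G S d → S (vertᴳ d) ≡ true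
    vert-inside (e , false) i = proj₁ (∧-elim {S (end e false)} i)
    vert-inside (e , true)  i = proj₂ (∧-elim {S (end e false)} i)

    -- The two darts of an outside edge form a 2-cycle of σ, counted exactly once because the dart
    -- labelled `false` has the smaller key.
    orbits-outside : (σ : Perm 𝔻) → (∀ d → inS d ≡ false → to σ d ≡ θᴳ d) →
                     orbits (to σ) ≡ # (λ d → inS d ∧ minRep (to σ) d) + count (not ∘ edgeInᵇ G S)
    orbits-outside σ out = trans (sumFin-cong split)
      (sumFin-+ (λ e → bit (edgeInᵇ G S e ∧ minRep (to σ) (e , false)) + bit (edgeInᵇ G S e ∧ minRep (to σ) (e , true))) _)
      where
      split : ∀ e → bit (minRep (to σ) (e , false)) + bit (minRep (to σ) (e , true)) ≡
              bit (edgeInᵇ G S e ∧ minRep (to σ) (e , false)) + bit (edgeInᵇ G S e ∧ minRep (to σ) (e , true))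
              + bit (not (edgeInᵇ G S e))
      split e with edgeInᵇ G S e in eq
      ... | true  = sym (+-identityʳ _)
      ... | false = cong₂ (λ x y → bit x + bit y) false-rep true-not-rep
        where
        stays : ∀ k → iter (to σ) k (e , false) ≡ (e , false) ⊎ iter (to σ) k (e , false) ≡ (e , true)
        stays zero = inj₁ refl
        stays (suc k) with stays k
        ... | inj₁ p = inj₂ (trans (cong (to σ) p) (out _ eq))
        ... | inj₂ p = inj₁ (trans (cong (to σ) p) (out _ eq))
        false-rep : minRep (to σ) (e , false) ≡ true
        false-rep = allBelow-intro (suc (nDarts G)) _ λ {k} _ → ≤ᵇ-true (le k)
          where
          le : ∀ k → key G (e , false) ≤ key G (iter (to σ) k (e , false))
          le k with stays k
          ... | inj₁ p = ≤-reflexive (cong (key G) (sym p))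
          ... | inj₂ p = ≤-trans (+-monoʳ-≤ (2 * toℕ e) z≤n) (≤-reflexive (cong (key G) (sym p)))
        true-not-rep : minRep (to σ) (e , true) ≡ false
        true-not-rep with minRep (to σ) (e , true) in m
        ... | false = refl
        ... | true  = contradiction
                (+-cancelˡ-≤ (2 * toℕ e) 1 0 (≤-trans (minRep-≤ σ m ~-step) (≤-reflexive (cong (key G) (out _ eq)))))
                λ ()

  module _ {S : VSet G} (r : Rotation G S) where
    open Rotation r

    rotation-perm : Perm 𝔻
    rotation-perm = record { to = ρ ; from = ρ⁻¹ ; to-from = ρρ⁻¹ ; from-to = ρ⁻¹ρ }

    -- On a finite set the predecessor of `d` is also a forward iterate of `d`, so forward closure
    -- suffices.
    closed⁻¹ : ∀ {d} → DartIn G S d → DartIn G S (ρ⁻¹ d)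
    closed⁻¹ {d} = ~-invariant (DartIn G S) (λ {x} → closed x) (~-sym rotation-perm (1 , ρρ⁻¹ d))

    ρ̂ : Perm 𝔻
    ρ̂ = record { to = on ρ ; from = on ρ⁻¹ ; to-from = inverse ρ ρ⁻¹ closed⁻¹ ρρ⁻¹ ; from-to = inverse ρ⁻¹ ρ (λ {x} → closed x) ρ⁻¹ρ }
      where
      on : (𝔻 → 𝔻) → 𝔻 → 𝔻
      on f d = if inS S d then f d else d
      inverse : ∀ f g → (∀ {d} → DartIn G S d → DartIn G S (g d)) → (∀ d → f (g d) ≡ d) → ∀ d → on f (on g d) ≡ d
      inverse f g closed fg d with inS S d in eq
      ... | false rewrite eq = refl
      ... | true  rewrite closed {d} eq = fg d

    ρ̂-inside : ∀ {d} → DartIn G S d → to ρ̂ d ≡ ρ d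
    ρ̂-inside eq rewrite eq = refl

    ρ̂-outside : ∀ {d} → inS S d ≡ false → to ρ̂ d ≡ d
    ρ̂-outside eq rewrite eq = refl

    ρ̂-closed : ∀ {d} → DartIn G S d → DartIn G S (to ρ̂ d)
    ρ̂-closed eq = subst (DartIn G S) (sym (ρ̂-inside eq)) (closed _ eq)

    ρ̂-vert : ∀ d → vertᴳ (to ρ̂ d) ≡ vertᴳ d
    ρ̂-vert d with inS S d in eq
    ... | true  = atVert d eq
    ... | false = refl

    ρ̂-cyclic : ∀ {d d'} → DartIn G S d → DartIn G S d' → vertᴳ d ≡ vertᴳ d' → to ρ̂ ⊢ d ~ d'
    ρ̂-cyclic {d} {d'} in-d in-d' eq with cyclic d d' in-d in-d' eq
    ... | k , arrive = k , trans (proj₂ (agree k)) arrive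
      where
      agree : ∀ k → DartIn G S (iter ρ k d) × iter (to ρ̂) k d ≡ iter ρ k d
      agree zero = in-d , refl
      agree (suc k) with agree k
      ... | i , eq = closed _ i , trans (cong (to ρ̂) eq) (ρ̂-inside i)

    φ̂ : Perm 𝔻
    φ̂ = ρ̂ ⊙ θ-perm

    faceOrbits : ℕ
    faceOrbits = # (isRep G r)

    orbits-φ̂ : orbits (to φ̂) ≡ faceOrbits + count (not ∘ edgeInᵇ G S)
    orbits-φ̂ = trans (orbits-outside S φ̂ λ d out → ρ̂-outside {θᴳ d} out)
      (cong (_+ count (not ∘ edgeInᵇ G S)) (sumFin-cong λ e → cong₂ (λ x y → bit x + bit y) (same (e , false)) (same (e , true))))
      where
      agree : ∀ {d} → DartIn G S d → ∀ k → DartIn G S (iter (φ G r) k d) × iter (to φ̂) k d ≡ iter (φ G r) k d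
      agree i zero = i , refl
      agree {d} i (suc k) with agree i k
      ... | j , eq = closed (θᴳ (iter (φ G r) k d)) j , trans (cong (to φ̂) eq) (ρ̂-inside {θᴳ (iter (φ G r) k d)} j)
      same : ∀ d → inS S d ∧ minRep (to φ̂) d ≡ isRep G r d
      same d with inS S d in i
      ... | false = refl
      ... | true  = allBelow-cong (suc (nDarts G)) λ k → cong (λ x → key G d ≤ᵇ key G x) (proj₂ (agree i k))

  add-edge-transposed : ∀ (σ : Perm 𝔻) q q' e → q e ≡ false → q' e ≡ true → (∀ e' → e' ≢ e → q' e' ≡ q e') →
    Transposed (to (σ ⊙ flipOn q)) (to (σ ⊙ flipOn q')) (e , false) (e , true)
  add-edge-transposed σ q q' e qe q'e off = record
    { at-a = cong (to σ) (trans (flipOn-true q' q'e) (sym (flipOn-false q qe)))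
    ; at-b = cong (to σ) (trans (flipOn-true q' q'e) (sym (flipOn-false q qe)))
    ; off  = λ d d≢f d≢t → cong (λ c → to σ (if c then θᴳ d else d)) (off (proj₁ d) (other d d≢f d≢t))
    }
    where
    other : ∀ d → d ≢ (e , false) → d ≢ (e , true) → proj₁ d ≢ e
    other (_ , false) d≢f _ refl = d≢f refl
    other (_ , true)  _ d≢t refl = d≢t refl

  -- Euler's inequality

  module Euler {S : VSet G} (conn : Connected G S) (r : Rotation G S) where
    private
      V = nVerts G S
      E = nEdges G S
      E# = finCounting nE

    partial : (Fin nE → Bool) → Perm 𝔻
    partial q = ρ̂ r ⊙ flipOn q

    roots : (Fin nV → Fin nV) → ℕ
    roots L = count (λ a → S a ∧ does (L a ≟ᶠ a))

    -- q marks the edges already glued to the vertices of G[S] (edges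
    -- outside G[S] are marked from the start); L labels the components
    -- of the graph formed by the marked edges.
    record Glued (q : Fin nE → Bool) (L : Fin nV → Fin nV) : Set where
      field
        inside : ∀ e → q e ≡ false → edgeInᵇ G S e ≡ true
        linked : ∀ e → edgeInᵇ G S e ≡ true → q e ≡ true → L (end e false) ≡ L (end e true)
        -- Marking an edge either adds at most one orbit or removes an orbit and a root; both bounds
        -- survive. With all edges marked and one root left, the first bounds the orbits of ρθ, and
        -- the second covers the default face 1.
        orbit-bound : orbits (to (partial q)) + V + count (not ∘ q) ≤ nE + 2 * roots L
        vertex-bound : V + count (not ∘ q) ≤ E + roots L

      label-invariant : ∀ {d} → DartIn G S d → L (vertᴳ (to (partial q) d)) ≡ L (vertᴳ d)
      label-invariant {d} i = trans (cong L (ρ̂-vert r (to (flipOn q) d))) (flip-label d i)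
        where
        flip-label : ∀ d → DartIn G S d → L (vertᴳ (to (flipOn q) d)) ≡ L (vertᴳ d)
        flip-label (e , b) i with q e in eq
        flip-label (e , b)     i | false = refl
        flip-label (e , false) i | true  = sym (linked e i eq)
        flip-label (e , true)  i | true  = linked e i eq

      partial-closed : ∀ {d} → DartIn G S d → DartIn G S (to (partial q) d)
      partial-closed {d} i = ρ̂-closed r {to (flipOn q) d} flip-closed
        where
        flip-closed : DartIn G S (to (flipOn q) d)
        flip-closed with q (proj₁ d)
        ... | false = i
        ... | true  = i

      -- The rotation keeps the vertex, and a marked edge joins equal labels, so no orbit leaves its
      -- component.
      same-label : ∀ {d d'} → DartIn G S d → to (partial q) ⊢ d ~ d' → L (vertᴳ d') ≡ L (vertᴳ d)
      same-label {d} i d~d' = proj₂ (~-invariant (λ x → DartIn G S x × L (vertᴳ x) ≡ L (vertᴳ d))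
        (λ { (j , eq) → partial-closed j , trans (label-invariant j) eq }) d~d' (i , refl))

    module _ {q : Fin nE → Bool} {L : Fin nV → Fin nV} (e : Fin nE) (gl : Glued q L) (qe : q e ≡ false)
             (q' : Fin nE → Bool) (q'e : q' e ≡ true)
             (off : ∀ e' → e' ≢ e → q' e' ≡ q e') where
      open Glued gl

      private
        transp = add-edge-transposed (ρ̂ r) q q' e qe q'e off
        o = orbits (to (partial q))
        o' = orbits (to (partial q'))
        j = count (not ∘ q)
        j' = count (not ∘ q')

        j≡ : j ≡ suc j'
        j≡ = Counting.#-drop E# (not ∘ q) (not ∘ q') e (cong not qe) (cong not q'e) λ e' e'≢e → cong not (sym (off e' e'≢e))

        inside' : ∀ e' → q' e' ≡ false → edgeInᵇ G S e' ≡ true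
        inside' e' q'e' with e' ≟ᶠ e
        ... | yes refl = contradiction q'e' (λ eq → true≢false q'e eq)
        ... | no e'≢e = inside e' (trans (sym (off e' e'≢e)) q'e')

        linked' : ∀ {L' : Fin nV → Fin nV} → (∀ {u v} → L u ≡ L v → L' u ≡ L' v) → L' (end e false) ≡ L' (end e true) →
                  ∀ e' → edgeInᵇ G S e' ≡ true → q' e' ≡ true → L' (end e' false) ≡ L' (end e' true)
        linked' coarser eq e' i q'e' with e' ≟ᶠ e
        ... | yes refl = eq
        ... | no e'≢e = coarser (linked e' i (trans (sym (off e' e'≢e)) q'e'))

      -- If the ends of `e` share a label, the orbit possibly gained is paid for by the unmarked
      -- edge lost. Otherwise the darts of `e` lie in different orbits by `same-label`, so the left
      -- side of `orbit-bound` falls by at least 2 (an orbit and an unmarked edge), the right side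
      -- by at most 2 (one root, counted twice).
      glue : ∃ (Glued q')
      glue with L (end e false) ≟ᶠ L (end e true)
      ... | yes eq = L , record
        { inside = inside'
        ; linked = linked' (λ l → l) eq
        ; orbit-bound = begin
            o' + V + j'         ≤⟨ +-monoˡ-≤ j' (+-monoˡ-≤ V (orbits-transposed (partial q) (partial q') transp)) ⟩
            suc (o + V + j')    ≡⟨ sym (+-suc (o + V) j') ⟩
            o + V + suc j'      ≡⟨ cong (o + V +_) j≡ ⟨
            o + V + j           ≤⟨ orbit-bound ⟩
            nE + 2 * roots L    ∎
        ; vertex-bound = ≤-trans (+-monoʳ-≤ V (≤-trans (n≤1+n j') (≤-reflexive (sym j≡)))) vertex-bound
        }
        where open ≤-Reasoning
      ... | no neq = L' , record
        { inside = inside'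
        ; linked = linked' (cong relabel) (trans (relabel-other neq) (sym relabel-y))
        ; orbit-bound = +-cancelˡ-≤ 2 _ _ (begin
            2 + (o' + V + j')       ≡⟨ solve 3 (λ a b c → con 2 :+ (a :+ b :+ c) := (con 1 :+ a) :+ b :+ (con 1 :+ c)) refl o' V j' ⟩
            suc o' + V + suc j'     ≤⟨ +-monoˡ-≤ (suc j') (+-monoˡ-≤ V (orbits-merged (partial q) (partial q') transp λ p~q → neq (sym (same-label (inside e qe) p~q)))) ⟩
            o + V + suc j'          ≡⟨ cong (o + V +_) j≡ ⟨
            o + V + j               ≤⟨ orbit-bound ⟩
            nE + 2 * roots L        ≤⟨ +-monoʳ-≤ nE (*-monoʳ-≤ 2 roots≤) ⟩
            nE + 2 * suc (roots L') ≡⟨ solve 2 (λ a b → a :+ con 2 :* (con 1 :+ b) := con 2 :+ (a :+ con 2 :* b)) refl nE (roots L') ⟩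
            2 + (nE + 2 * roots L') ∎)
        ; vertex-bound = +-cancelˡ-≤ 1 _ _ (begin
            suc (V + j')            ≡⟨ sym (+-suc V j') ⟩
            V + suc j'              ≡⟨ cong (V +_) j≡ ⟨
            V + j                   ≤⟨ vertex-bound ⟩
            E + roots L             ≤⟨ +-monoʳ-≤ E roots≤ ⟩
            E + suc (roots L')      ≡⟨ +-suc E _ ⟩
            suc (E + roots L')      ∎)
        }
        where
        open ≤-Reasoning
        open +-*-Solver
        x = L (end e false)
        y = L (end e true)
        relabel : Fin nV → Fin nV
        relabel a = if does (a ≟ᶠ y) then x else a
        L' : Fin nV → Fin nV
        L' v = relabel (L v)
        relabel-y : relabel y ≡ x
        relabel-y with y ≟ᶠ y
        ... | yes _ = refl
        ... | no y≢y = contradiction refl y≢y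
        relabel-other : ∀ {a} → a ≢ y → relabel a ≡ a
        relabel-other {a} a≢y with a ≟ᶠ y
        ... | yes eq = contradiction eq a≢y
        ... | no _ = refl
        roots≤ : roots L ≤ suc (roots L')
        roots≤ = #-mono-except (finCounting nV) _ _ y λ a root a≢y → let sa , la = ∧-elim {S a} root in ∧-intro sa (still-root a la a≢y)
          where
          still-root : ∀ a → does (L a ≟ᶠ a) ≡ true → a ≢ y → does (L' a ≟ᶠ a) ≡ true
          still-root a la a≢y with L a ≟ᶠ a
          ... | yes eq rewrite eq | relabel-other a≢y with a ≟ᶠ a
          ...   | yes _ = refl
          ...   | no a≢a = contradiction refl a≢a

    glue-all : ∀ j {q L} → count (not ∘ q) ≡ j → Glued q L →
               ∃ λ q' → (∀ e → q' e ≡ true) × ∃ (Glued q')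
    glue-all zero {q} {L} eq gl = q , all , L , gl
      where
      all : ∀ e → q e ≡ true
      all e with q e in qe
      ... | true  = refl
      ... | false = contradiction (trans (sym eq) (∖-# E# (not ∘ q) e (cong not qe))) λ ()
    glue-all (suc j) {q} {L} eq gl with Counting.#-find E# (not ∘ q) eq
    ... | e , nqe = glue-all j (suc-injective (trans (sym dropped) eq)) (proj₂ (glue e gl qe q' q'e off))
      where
      qe : q e ≡ false
      qe = trans (sym (not-involutive (q e))) (cong not nqe)
      q' : Fin nE → Bool
      q' e' = if does (e' ≟ᶠ e) then true else q e'
      q'e : q' e ≡ true
      q'e with e ≟ᶠ e
      ... | yes _ = refl
      ... | no e≢e = contradiction refl e≢e
      off : ∀ e' → e' ≢ e → q' e' ≡ q e'
      off e' e'≢e with e' ≟ᶠ e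
      ... | yes eq = contradiction eq e'≢e
      ... | no _ = refl
      dropped : count (not ∘ q) ≡ suc (count (not ∘ q'))
      dropped = Counting.#-drop E# (not ∘ q) (not ∘ q') e nqe (cong not q'e) λ e' e'≢e → cong not (sym (off e' e'≢e))

    initially : Glued (not ∘ edgeInᵇ G S) (λ v → v)
    initially = record
      { inside = λ e eq → trans (sym (not-involutive _)) (cong not eq)
      ; linked = λ e i ni → ⊥-elim (true≢false ni (cong not i))
      ; orbit-bound = begin
          o + V + j                ≡⟨ cong (λ m → m + V + j) (orbits-outside S σ₀ out) ⟩
          c + out# + V + j         ≤⟨ +-monoˡ-≤ j (+-monoˡ-≤ V (+-monoˡ-≤ out# c≤V)) ⟩
          V + out# + V + j         ≡⟨ cong (V + out# + V +_) j≡E ⟩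
          V + out# + V + E         ≡⟨ solve 3 (λ a b c → a :+ b :+ a :+ c := (c :+ b) :+ con 2 :* a) refl V out# E ⟩
          (E + out#) + 2 * V       ≡⟨ cong₂ (λ a b → a + 2 * b) (count-complement (edgeInᵇ G S)) V≡roots ⟩
          nE + 2 * roots (λ v → v) ∎
      ; vertex-bound = ≤-reflexive (trans (cong₂ _+_ V≡roots j≡E) (+-comm _ E))
      }
      where
      open ≤-Reasoning
      open +-*-Solver
      σ₀ = partial (not ∘ edgeInᵇ G S)
      o = orbits (to σ₀)
      j = count (not ∘ not ∘ edgeInᵇ G S)
      out# = count (not ∘ edgeInᵇ G S)
      c = # (λ d → inS S d ∧ minRep (to σ₀) d)
      out : ∀ d → inS S d ≡ false → to σ₀ d ≡ θᴳ d
      out d i = trans (cong (to (ρ̂ r)) (flipOn-true (not ∘ edgeInᵇ G S) {d} (cong not i))) (ρ̂-outside r {θᴳ d} i)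
      j≡E : j ≡ E
      j≡E = sumFin-cong λ e → cong bit (not-involutive (edgeInᵇ G S e))
      V≡roots : V ≡ roots (λ v → v)
      V≡roots = sumFin-cong λ v → cong bit (root v)
        where
        root : ∀ v → S v ≡ S v ∧ does (v ≟ᶠ v)
        root v with S v | v ≟ᶠ v
        ... | false | _ = refl
        ... | true  | yes _ = refl
        ... | true  | no v≢v = contradiction refl v≢v
      inner : ∀ {d} → DartIn G S d → to σ₀ d ≡ to (ρ̂ r) d
      inner {d} i = cong (to (ρ̂ r)) (flipOn-false (not ∘ edgeInᵇ G S) {d} (cong not i))
      cyclic₀ : ∀ {d d'} → DartIn G S d → DartIn G S d' → vertᴳ d ≡ vertᴳ d' → to σ₀ ⊢ d ~ d'
      cyclic₀ {d} i i' eq = let k , arrive = ρ̂-cyclic r i i' eq in k , trans (proj₂ (agree k)) arrive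
        where
        agree : ∀ k → DartIn G S (iter (to (ρ̂ r)) k d) × iter (to σ₀) k d ≡ iter (to (ρ̂ r)) k d
        agree zero = i , refl
        agree (suc k) with agree k
        ... | h , eq = ρ̂-closed r h , trans (cong (to σ₀) eq) (inner h)
      -- Before any inside edge is marked, the inside orbits are the rotations at single vertices; a
      -- vertex without darts has none, hence only an inequality.
      c≤V : c ≤ V
      c≤V = #-injection darts (finCounting nV) _ _ vertᴳ
        (λ d p → vert-inside S d (proj₁ (∧-elim {inS S d} p)))
        λ d d' p p' eq → let i , m = ∧-elim {inS S d} p ; i' , m' = ∧-elim {inS S d'} p' in
          minRep-unique σ₀ m m' (cyclic₀ i i' eq)

    euler : V + faces G r ≤ E + 2
    euler with glue-all _ refl initially
    ... | q , all , L , gl = bound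
      where
      open Glued gl
      open ≤-Reasoning
      out# = count (not ∘ edgeInᵇ G S)
      walk-label : ∀ {u w} → Walk G S u w → L u ≡ L w
      walk-label Walk.here = refl
      walk-label (Walk.step e false i refl w) = trans (linked e i (all e)) (walk-label w)
      walk-label (Walk.step e true  i refl w) = trans (sym (linked e i (all e))) (walk-label w)
      root : ∀ {a} → does (L a ≟ᶠ a) ≡ true → L a ≡ a
      root {a} eq with L a ≟ᶠ a
      ... | yes p = p
      roots≤1 : roots L ≤ 1
      roots≤1 = #-≤1 (finCounting nV) _ λ a b pa pb →
        let sa , la = ∧-elim {S a} pa ; sb , lb = ∧-elim {S b} pb in
        trans (sym (root la)) (trans (walk-label (proj₂ conn a b sa sb)) (root lb))
      V≤ : V + 1 ≤ E + 2
      V≤ = begin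
        V + 1                     ≤⟨ +-monoˡ-≤ 1 (≤-trans (m≤m+n V _) vertex-bound) ⟩
        E + roots L + 1           ≤⟨ +-monoˡ-≤ 1 (+-monoʳ-≤ E roots≤1) ⟩
        E + 1 + 1                 ≡⟨ +-assoc E 1 1 ⟩
        E + 2                     ∎
      same : ∀ d → to (φ̂ r) d ≡ to (partial q) d
      same d = cong (to (ρ̂ r)) (sym (flipOn-true q {d} (all (proj₁ d))))
      orbits≤ : V + faceOrbits r ≤ E + 2
      orbits≤ = +-cancelʳ-≤ out# _ _ (begin
        V + faceOrbits r + out#          ≡⟨ +-assoc V _ _ ⟩
        V + (faceOrbits r + out#)        ≡⟨ cong (V +_) (orbits-φ̂ r) ⟨
        V + orbits (to (φ̂ r))            ≤⟨ +-monoʳ-≤ V (orbits-cong same) ⟩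
        V + orbits (to (partial q))      ≡⟨ +-comm V _ ⟩
        orbits (to (partial q)) + V      ≤⟨ ≤-trans (m≤m+n _ _) orbit-bound ⟩
        nE + 2 * roots L                 ≤⟨ +-monoʳ-≤ nE (*-monoʳ-≤ 2 roots≤1) ⟩
        nE + 2                           ≡⟨ cong (_+ 2) (count-complement (edgeInᵇ G S)) ⟨
        E + out# + 2                     ≡⟨ trans (+-assoc E out# 2) (trans (cong (E +_) (+-comm out# 2)) (sym (+-assoc E 2 out#))) ⟩
        E + 2 + out#                     ∎)
      bound : V + (1 ⊔ faceOrbits r) ≤ E + 2
      bound with ⊔-sel 1 (faceOrbits r)
      ... | inj₁ eq rewrite eq = V≤
      ... | inj₂ eq rewrite eq = orbits≤

  -- Insertion of edges

  θ-injective : ∀ {d d'} → θᴳ d ≡ θᴳ d' → d ≡ d'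
  θ-injective {d} {d'} eq = trans (sym (θ-involutive d)) (trans (cong θᴳ eq) (θ-involutive d'))

  facePerm : Perm 𝔻 → Perm 𝔻
  facePerm ρ = ρ ⊙ θ-perm

  Φ : Perm 𝔻 → 𝔻 → 𝔻
  Φ ρ = to (facePerm ρ)

  faceCount : Perm 𝔻 → ℕ
  faceCount ρ = orbits (Φ ρ)

  -- D is the set of darts inserted so far; the others are fixed points of ρ.
  -- It need not be closed under θ, as the two darts of an edge are inserted
  -- one after the other.
  record Partial (D : 𝔻 → Set) (ρ : Perm 𝔻) : Set where
    field
      fixes    : ∀ {d} → ¬ D d → to ρ d ≡ d
      at-vert  : ∀ d → vertᴳ (to ρ d) ≡ vertᴳ d
      one-cycle : ∀ {d d'} → D d → D d' → vertᴳ d ≡ vertᴳ d' → to ρ ⊢ d ~ d'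

  Partial-resp : ∀ {D D' ρ} → (∀ {d} → D d → D' d) → (∀ {d} → D' d → D d) → Partial D ρ → Partial D' ρ
  Partial-resp f g P = record
    { fixes = λ ¬d → fixes (¬d ∘ f) ; at-vert = at-vert ; one-cycle = λ x y → one-cycle (g x) (g y) }
    where open Partial P

  infixl 5 _∪_ _⊕_ _⊞_
  _∪_ _⊕_ : (𝔻 → Set) → 𝔻 → 𝔻 → Set
  (D ∪ d) z = D z ⊎ z ≡ d
  (D ⊕ d) z = D z ⊎ z ≡ d ⊎ z ≡ θᴳ d

  _⊞_ : (𝔻 → Set) → List 𝔻 → 𝔻 → Set
  _⊞_ = foldl _⊕_

  swap-vert : ∀ {x d} → vertᴳ x ≡ vertᴳ d → ∀ z → vertᴳ (sw x d z) ≡ vertᴳ z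
  swap-vert {x} {d} eq z with z ≟ᵈ x
  ... | yes refl = sym eq
  ... | no _ with z ≟ᵈ d
  ...   | yes refl = eq
  ...   | no _ = refl

  face-transposed : ∀ ρ x d → Transposed (Φ ρ) (Φ (ρ ⊙ tr x d)) (θᴳ x) (θᴳ d)
  face-transposed ρ x d = record
    { at-a = cong (to ρ) (trans (cong (sw x d) (θ-involutive x)) (trans (swap-left darts x d) (sym (θ-involutive d))))
    ; at-b = cong (to ρ) (trans (cong (sw x d) (θ-involutive d)) (trans (swap-right darts x d) (sym (θ-involutive x))))
    ; off = λ z z≢θx z≢θd → cong (to ρ) (swap-other darts (λ eq → z≢θx (shift eq)) (λ eq → z≢θd (shift eq)))
    }
    where
    shift : ∀ {z w} → θᴳ z ≡ w → z ≡ θᴳ w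
    shift {z} eq = trans (sym (θ-involutive z)) (cong θᴳ eq)

  -- As `d` is fixed by ρ, the transposition merges it into the cycle of `x` and keeps all other
  -- cycles together.
  insert-after : ∀ {D ρ x d} → Partial D ρ → D x → ¬ D d → vertᴳ x ≡ vertᴳ d → Partial (D ∪ d) (ρ ⊙ tr x d)
  insert-after {D} {ρ} {x} {d} P Dx ¬Dd vx = record
    { fixes = λ {z} ¬z → trans (cong (to ρ) (swap-other darts (λ { refl → ¬z (inj₁ Dx) }) (¬z ∘ inj₂))) (fixes (¬z ∘ inj₁))
    ; at-vert = λ z → trans (at-vert _) (swap-vert vx z)
    ; one-cycle = cyc
    }
    where
    open Partial P
    ρ' = ρ ⊙ tr x d
    t = swap-transposed darts ρ x d
    x≁d : ¬ to ρ ⊢ x ~ d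
    x≁d x~d = ¬Dd (subst D (~-invariant (_≡ d) (λ eq → trans (cong (to ρ) eq) (fixes ¬Dd)) (~-sym ρ x~d) refl) Dx)
    x~'d : to ρ' ⊢ x ~ d
    x~'d = merged ρ ρ' t x≁d
    cyc : ∀ {y z} → (D ∪ d) y → (D ∪ d) z → vertᴳ y ≡ vertᴳ z → to ρ' ⊢ y ~ z
    cyc (inj₁ Dy) (inj₁ Dz) eq = merged-coarser ρ ρ' t x≁d (one-cycle Dy Dz eq)
    cyc (inj₁ Dy) (inj₂ refl) eq = ~-trans (merged-coarser ρ ρ' t x≁d (one-cycle Dy Dx (trans eq (sym vx)))) x~'d
    cyc (inj₂ refl) (inj₁ Dz) eq = ~-trans (~-sym ρ' x~'d) (merged-coarser ρ ρ' t x≁d (one-cycle Dx Dz (trans vx eq)))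
    cyc (inj₂ refl) (inj₂ refl) eq = ~-refl

  -- A fixed point is already a full rotation at a vertex with one dart, so ρ need not change.
  insert-new : ∀ {D ρ d} → Partial D ρ → (∀ {z} → D z → vertᴳ z ≢ vertᴳ d) → Partial (D ∪ d) ρ
  insert-new {D} {ρ} {d} P new = record
    { fixes = λ ¬z → fixes (¬z ∘ inj₁) ; at-vert = at-vert ; one-cycle = cyc }
    where
    open Partial P
    cyc : ∀ {y z} → (D ∪ d) y → (D ∪ d) z → vertᴳ y ≡ vertᴳ z → to ρ ⊢ y ~ z
    cyc (inj₁ Dy) (inj₁ Dz) eq = one-cycle Dy Dz eq
    cyc (inj₁ Dy) (inj₂ refl) eq = contradiction eq (new Dy)
    cyc (inj₂ refl) (inj₁ Dz) eq = contradiction (sym eq) (new Dz)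
    cyc (inj₂ refl) (inj₂ refl) eq = ~-refl

  ∪∪⇒⊕ : ∀ {D ρ d} → Partial ((D ∪ d) ∪ θᴳ d) ρ → Partial (D ⊕ d) ρ
  ∪∪⇒⊕ = Partial-resp
    (λ { (inj₁ (inj₁ p)) → inj₁ p ; (inj₁ (inj₂ p)) → inj₂ (inj₁ p) ; (inj₂ p) → inj₂ (inj₂ p) })
    (λ { (inj₁ p) → inj₁ (inj₁ p) ; (inj₂ (inj₁ p)) → inj₁ (inj₂ p) ; (inj₂ (inj₂ p)) → inj₂ p })

  θ-≢ : ∀ d → θᴳ d ≢ d
  θ-≢ (e , false) ()
  θ-≢ (e , true)  ()

  -- An edge with both darts absent is the orbit {d, θ d} of ρθ.
  absent-orbit : ∀ {D ρ d} → Partial D ρ → ¬ D d → ¬ D (θᴳ d) → ∀ {y} → D y → ¬ Φ ρ ⊢ θᴳ y ~ d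
  absent-orbit {D} {ρ} {d} P ¬d ¬θd {y} Dy θy~d with ~-invariant (λ z → z ≡ d ⊎ z ≡ θᴳ d) closed (~-sym (facePerm ρ) θy~d) (inj₁ refl)
    where
    open Partial P
    closed : ∀ {z} → z ≡ d ⊎ z ≡ θᴳ d → Φ ρ z ≡ d ⊎ Φ ρ z ≡ θᴳ d
    closed (inj₁ refl) = inj₂ (fixes ¬θd)
    closed (inj₂ refl) = inj₁ (trans (cong (to ρ) (θ-involutive d)) (fixes ¬d))
  ... | inj₁ eq = ¬θd (subst D (trans (sym (θ-involutive y)) (cong θᴳ eq)) Dy)
  ... | inj₂ eq = ¬d (subst D (θ-injective eq) Dy)

  module InsertEdge {D ρ x y d} (P : Partial D ρ) (Dx : D x) (Dy : D y) (¬d : ¬ D d) (¬θd : ¬ D (θᴳ d))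
                    (vx : vertᴳ x ≡ vertᴳ d) (vy : vertᴳ y ≡ vertᴳ (θᴳ d)) where
    open Partial P
    ρ₁ ρ₂ : Perm 𝔻
    ρ₁ = ρ ⊙ tr x d
    ρ₂ = ρ₁ ⊙ tr y (θᴳ d)

    private
      t₁ : Transposed (Φ ρ) (Φ ρ₁) (θᴳ x) (θᴳ d)
      t₁ = face-transposed ρ x d
      t₂ : Transposed (Φ ρ₁) (Φ ρ₂) (θᴳ y) d
      t₂ = subst (Transposed (Φ ρ₁) (Φ ρ₂) (θᴳ y)) (θ-involutive d) (face-transposed ρ₁ y (θᴳ d))
      absent : ∀ {z} → D z → ¬ Φ ρ ⊢ θᴳ z ~ d
      absent = absent-orbit P ¬d ¬θd
      absentθ : ∀ {z} → D z → ¬ Φ ρ ⊢ θᴳ z ~ θᴳ d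
      absentθ = absent-orbit P ¬θd (¬d ∘ subst D (θ-involutive d))

    result : Partial (D ⊕ d) ρ₂
    result = ∪∪⇒⊕ (insert-after (insert-after P Dx ¬d vx) (inj₁ Dy) (λ { (inj₁ p) → ¬θd p ; (inj₂ eq) → θ-≢ d eq }) vy)

    -- The 2-cycle of the absent edge is absorbed into the face of `θ x`. This loss offsets the
    -- orbit that the second dart may create.
    count₁ : suc (faceCount ρ₁) ≤ faceCount ρ
    count₁ = orbits-merged (facePerm ρ) (facePerm ρ₁) t₁ (absentθ Dx)

    count₂ : faceCount ρ₂ ≤ faceCount ρ
    count₂ = ≤-trans (orbits-transposed (facePerm ρ₁) (facePerm ρ₂) t₂) count₁

    count-merge : ¬ Φ ρ₁ ⊢ θᴳ y ~ d → 2 + faceCount ρ₂ ≤ faceCount ρ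
    count-merge y≁d = ≤-trans (s≤s (orbits-merged (facePerm ρ₁) (facePerm ρ₂) t₂ y≁d)) count₁

    -- After the first dart, `d` can share an orbit with `θ y` only through the face of `θ x` or
    -- through the old 2-cycle of the edge; the latter contains no `θ z` with `z` present.
    distinct-faces : ¬ Φ ρ ⊢ θᴳ y ~ θᴳ x → ¬ Φ ρ₁ ⊢ θᴳ y ~ d
    distinct-faces y≁x y~d with transposed-⊆ (facePerm ρ) (facePerm ρ₁) t₁ y~d
    ... | inj₁ p = absent Dy p
    ... | inj₂ (inj₁ (p , _)) = y≁x p
    ... | inj₂ (inj₂ (p , _)) = absentθ Dy p

    -- The face of θ x contains d: the new edge has different faces on its
    -- two sides.
    two-sides : Φ ρ₁ ⊢ θᴳ y ~ d → vertᴳ x ≢ vertᴳ y → ¬ Φ ρ₂ ⊢ θᴳ x ~ θᴳ d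
    -- One step of the new face permutation leads from `θ x` to `d` and from `θ y` to `θ d`, so it
    -- is enough that the second transposition separates `θ y` from `d`.
    two-sides y~d vx≢vy x~θd = separated (facePerm ρ₁) (facePerm ρ₂) t₂ θy≢d y~d
        (~-trans y~θd (~-trans (~-sym (facePerm ρ₂) x~θd) x~d))
      where
      θy≢d : θᴳ y ≢ d
      θy≢d refl = ¬θd (subst D (sym (θ-involutive y)) Dy)
      x~d : Φ ρ₂ ⊢ θᴳ x ~ d
      x~d = 1 , (begin
        to ρ₂ (θᴳ (θᴳ x))         ≡⟨ cong (to ρ₂) (θ-involutive x) ⟩
        to ρ₁ (sw y (θᴳ d) x)     ≡⟨ cong (to ρ₁) (swap-other darts (vx≢vy ∘ cong vertᴳ) (λ { refl → ¬θd Dx })) ⟩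
        to ρ (sw x d x)           ≡⟨ cong (to ρ) (swap-left darts x d) ⟩
        to ρ d                    ≡⟨ fixes ¬d ⟩
        d                         ∎)
        where open ≡-Reasoning
      y~θd : Φ ρ₂ ⊢ θᴳ y ~ θᴳ d
      y~θd = 1 , (begin
        to ρ₂ (θᴳ (θᴳ y))         ≡⟨ cong (to ρ₂) (θ-involutive y) ⟩
        to ρ₁ (sw y (θᴳ d) y)     ≡⟨ cong (to ρ₁) (swap-left darts y (θᴳ d)) ⟩
        to ρ (sw x d (θᴳ d))      ≡⟨ cong (to ρ) (swap-other darts (λ { refl → ¬θd Dx }) (θ-≢ d)) ⟩
        to ρ (θᴳ d)               ≡⟨ fixes ¬θd ⟩
        θᴳ d                      ∎)
        where open ≡-Reasoning

  -- Attaching a vertex by an odd number of edges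

  record Attachable (v : Fin nV) (D : 𝔻 → Set) (d : 𝔻) : Set where
    field
      at-v     : vertᴳ d ≡ v
      no-loop  : vertᴳ (θᴳ d) ≢ v
      absent   : ¬ D d
      absentθ  : ¬ D (θᴳ d)
      anchor   : ∃ λ y → D y × vertᴳ y ≡ vertᴳ (θᴳ d)

  absent-⊕ : ∀ {v D d d'} → vertᴳ d ≡ v → vertᴳ (θᴳ d) ≢ v → vertᴳ d' ≡ v → vertᴳ (θᴳ d') ≢ v → d ≢ d' →
             ¬ D d' → ¬ D (θᴳ d') → ¬ (D ⊕ d) d' × ¬ (D ⊕ d) (θᴳ d')
  absent-⊕ {d = d} {d'} refl nd vd' nd' d≢d' ¬d' ¬θd' =
    (λ { (inj₁ p) → ¬d' p ; (inj₂ (inj₁ eq)) → d≢d' (sym eq) ; (inj₂ (inj₂ refl)) → nd vd' }) ,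
    (λ { (inj₁ p) → ¬θd' p ; (inj₂ (inj₁ refl)) → nd' refl ; (inj₂ (inj₂ eq)) → d≢d' (sym (θ-injective eq)) })

  Attachable-⊕ : ∀ {v D d d'} → Attachable v D d → d ≢ d' → Attachable v D d' → Attachable v (D ⊕ d) d'
  Attachable-⊕ {D = D} A d≢d' A' = let ¬d' , ¬θd' = absent-⊕ {D = D} A.at-v A.no-loop at-v no-loop d≢d' absent absentθ in record
    { at-v = at-v ; no-loop = no-loop ; absent = ¬d' ; absentθ = ¬θd'
    ; anchor = let y , Dy , vy = anchor in y , inj₁ Dy , vy }
    where
    module A = Attachable A
    open Attachable A'

  Attachables-⊕ : ∀ {v D d ds} → Attachable v D d → All (d ≢_) ds → All (Attachable v D) ds → All (Attachable v (D ⊕ d)) ds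
  Attachables-⊕ A d≢ As = All.zipWith (λ { (neq , A') → Attachable-⊕ A neq A' }) (d≢ , As)

  Extension : (𝔻 → Set) → Perm 𝔻 → ℕ → Set
  Extension D ρ m = ∃ λ ρ' → Partial D ρ' × faceCount ρ' + m ≤ faceCount ρ

  -- If the first edge splits a face, then v lies on both parts, and one
  -- of them differs from the face chosen for the second edge.
  insert-pair : ∀ {v D ρ x d₁ d₂} → Partial D ρ → D x → vertᴳ x ≡ v → d₁ ≢ d₂ →
                Attachable v D d₁ → Attachable v D d₂ → Extension ((D ⊕ d₁) ⊕ d₂) ρ 2
  insert-pair {v} {D} {ρ} {x} {d₁} {d₂} P Dx vx d₁≢d₂ A₁ A₂ with Attachable.anchor A₁ | Attachable.anchor A₂
  ... | y₁ , Dy₁ , vy₁ | y₂ , Dy₂ , vy₂ = insert (~-dec (facePerm E₁.ρ₁) (θᴳ y₁) d₁)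
    where
    module A₁ = Attachable A₁
    module A₂ = Attachable A₂
    A₂' = Attachable-⊕ A₁ d₁≢d₂ A₂
    module E₁ = InsertEdge P Dx Dy₁ A₁.absent A₁.absentθ (trans vx (sym A₁.at-v)) vy₁
    module E₂ {x'} (Dx' : (D ⊕ d₁) x') (vx' : vertᴳ x' ≡ v) = InsertEdge E₁.result Dx' (inj₁ Dy₂)
      (Attachable.absent A₂') (Attachable.absentθ A₂') (trans vx' (sym A₂.at-v)) vy₂
    second-merges : ∀ {x'} (Dx' : (D ⊕ d₁) x') (vx' : vertᴳ x' ≡ v) → ¬ Φ E₁.ρ₂ ⊢ θᴳ y₂ ~ θᴳ x' →
                    Extension ((D ⊕ d₁) ⊕ d₂) ρ 2
    second-merges Dx' vx' y≁x = ρ₂ , result ,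
      ≤-trans (≤-reflexive (+-comm _ 2)) (≤-trans (count-merge (distinct-faces y≁x)) E₁.count₂)
      where open E₂ Dx' vx'
    insert : Dec (Φ E₁.ρ₁ ⊢ θᴳ y₁ ~ d₁) → Extension ((D ⊕ d₁) ⊕ d₂) ρ 2
    -- The first edge joins two faces and already lowers the total by 2; no choice for the second
    -- edge can raise it.
    insert (no y≁d) = ρ₂ , result ,
      ≤-trans (≤-reflexive (+-comm _ 2)) (≤-trans (+-monoʳ-≤ 2 count₂) (E₁.count-merge y≁d))
      where open E₂ (inj₁ Dx) vx
    insert (yes y~d) with ~-dec (facePerm E₁.ρ₂) (θᴳ y₂) (θᴳ x)
    ... | no y≁x = second-merges (inj₁ Dx) vx y≁x
    -- `θ y₂` lies on the side of `θ x`, hence not on that of `θ d₁`; the second edge is therefore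
    -- inserted after `d₁` instead of `x`.
    ... | yes y~x = second-merges (inj₂ (inj₁ refl)) A₁.at-v λ y~θd₁ →
            E₁.two-sides y~d (λ eq → A₁.no-loop (trans (sym vy₁) (trans (sym eq) vx)))
              (~-trans (~-sym (facePerm E₁.ρ₂) y~x) y~θd₁)

  insert-even : ∀ {v D ρ x} k ds → length ds ≡ 2 * k → Partial D ρ → D x → vertᴳ x ≡ v →
                Unique ds → All (Attachable v D) ds → Extension (D ⊞ ds) ρ (length ds)
  insert-even k [] eq P Dx vx _ _ = _ , P , ≤-reflexive (+-identityʳ _)
  insert-even k (d ∷ []) eq = contradiction (sym eq) (even≢odd k 0)
  insert-even zero (d₁ ∷ d₂ ∷ ds) ()
  insert-even (suc k) (d₁ ∷ d₂ ∷ ds) eq P Dx vx ((d₁≢d₂ ∷ d₁≢) ∷ d₂≢ ∷ u) (A₁ ∷ A₂ ∷ As)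
    with insert-pair P Dx vx d₁≢d₂ A₁ A₂
  ... | ρ' , P' , le with insert-even k ds (suc-injective (suc-injective (trans eq (*-suc 2 k)))) P' (inj₁ (inj₁ Dx)) vx u
                           (Attachables-⊕ (Attachable-⊕ A₁ d₁≢d₂ A₂) d₂≢ (Attachables-⊕ A₁ d₁≢ As))
  ...   | ρ″ , P″ , le' = ρ″ , P″ , (begin
    faceCount ρ″ + (2 + length ds)   ≡⟨ trans (cong (faceCount ρ″ +_) (+-comm 2 (length ds))) (sym (+-assoc (faceCount ρ″) (length ds) 2)) ⟩
    faceCount ρ″ + length ds + 2     ≤⟨ +-monoˡ-≤ 2 le' ⟩
    faceCount ρ' + 2                 ≤⟨ le ⟩
    _                                ∎)
    where open ≤-Reasoning

  -- As the first dart at `v`, `d` needs no transposition; that of `θ d` merges the absent 2-cycle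
  -- into a face, so the total falls by one. Then `d` is the dart at `v` from which the even
  -- remainder is inserted.
  insert-odd : ∀ {v D ρ} k ds → length ds ≡ suc (2 * k) → Partial D ρ → (∀ {z} → D z → vertᴳ z ≢ v) →
               Unique ds → All (Attachable v D) ds → Extension (D ⊞ ds) ρ (length ds)
  insert-odd {v} {D} {ρ} k (d ∷ ds) eq P new (d≢ ∷ u) (A ∷ As) with Attachable.anchor A
  ... | y , Dy , vy with insert-even k ds (suc-injective eq) P' (inj₂ (inj₁ refl)) at-v u (Attachables-⊕ A d≢ As)
    where
    open Attachable A
    ρ' = ρ ⊙ tr y (θᴳ d)
    P' : Partial (D ⊕ d) ρ'
    P' = ∪∪⇒⊕ (insert-after (insert-new P λ Dz eq → new Dz (trans eq at-v)) (inj₁ Dy)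
           (λ { (inj₁ p) → absentθ p ; (inj₂ eq) → θ-≢ d eq }) vy)
  ...   | ρ″ , P″ , le = ρ″ , P″ , (begin
    faceCount ρ″ + suc (length ds)   ≡⟨ +-suc _ _ ⟩
    suc (faceCount ρ″ + length ds)   ≤⟨ s≤s le ⟩
    suc (faceCount ρ')               ≤⟨ orbits-merged (facePerm ρ) (facePerm ρ') t (absent-orbit P absent absentθ Dy) ⟩
    faceCount ρ                      ∎)
    where
    open ≤-Reasoning
    open Attachable A
    ρ' = ρ ⊙ tr y (θᴳ d)
    t : Transposed (Φ ρ) (Φ ρ') (θᴳ y) d
    t = subst (Transposed (Φ ρ) (Φ ρ') (θᴳ y)) (θ-involutive d) (face-transposed ρ y (θᴳ d))

  -- Over a single vertex without darts, both darts of the first edge are the first at their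
  -- vertices, so ρ is unchanged and the 2-cycle of the edge itself becomes a face. The `suc` is
  -- this face, which replaces the default one.
  insert-first : ∀ {u v D ρ} k ds → length ds ≡ suc (2 * k) → Partial D ρ → (∀ {z} → ¬ D z) → u ≢ v →
                 Unique ds → All (λ d → vertᴳ d ≡ v × vertᴳ (θᴳ d) ≡ u) ds →
                 ∃ λ ρ' → Partial (D ⊞ ds) ρ' × faceCount ρ' + length ds ≤ suc (faceCount ρ)
  insert-first {u} {v} {D} {ρ} k (d ∷ ds) eq P empty u≢v (d≢ ∷ un) ((vd , vθd) ∷ vs)
    with insert-even k ds (suc-injective eq) P' (inj₂ (inj₁ refl)) vd un
           (All.zipWith (λ { {d'} (neq , vd' , vθd') → attachable d' neq vd' vθd' }) (d≢ , vs))
    where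
    P' : Partial (D ⊕ d) ρ
    P' = ∪∪⇒⊕ (insert-new (insert-new P λ Dz → contradiction Dz empty)
           λ { (inj₁ Dz) → contradiction Dz empty ; (inj₂ refl) eq → u≢v (trans (sym vθd) (trans (sym eq) vd)) })
    attachable : ∀ d' → d ≢ d' → vertᴳ d' ≡ v → vertᴳ (θᴳ d') ≡ u → Attachable v (D ⊕ d) d'
    attachable d' neq vd' vθd' =
      let ¬d' , ¬θd' = absent-⊕ {D = D} vd (λ eq → u≢v (trans (sym vθd) eq)) vd' (λ eq → u≢v (trans (sym vθd') eq)) neq empty empty in record
      { at-v = vd' ; no-loop = λ eq → u≢v (trans (sym vθd') eq) ; absent = ¬d' ; absentθ = ¬θd'
      ; anchor = θᴳ d , inj₂ (inj₂ refl) , trans vθd (sym vθd') }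
  ... | ρ' , P″ , le = ρ' , P″ , ≤-trans (≤-reflexive (+-suc _ _)) (s≤s le)

  ⊞-mono : ∀ {D} ds {z} → D z → (D ⊞ ds) z
  ⊞-mono []       Dz = Dz
  ⊞-mono (d ∷ ds) Dz = ⊞-mono ds (inj₁ Dz)

  ⊞-∈ : ∀ {D} {ds} {z} → z ∈ ds → (D ⊞ ds) z × (D ⊞ ds) (θᴳ z)
  ⊞-∈ {ds = d ∷ ds} (here refl) = ⊞-mono ds (inj₂ (inj₁ refl)) , ⊞-mono ds (inj₂ (inj₂ refl))
  ⊞-∈ {ds = d ∷ ds} (there z∈)  = ⊞-∈ z∈

  ⊞-elim : ∀ {D} ds {z} → (D ⊞ ds) z → D z ⊎ z ∈ ds ⊎ θᴳ z ∈ ds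
  ⊞-elim [] Dz = inj₁ Dz
  ⊞-elim (d ∷ ds) {z} p with ⊞-elim ds p
  ... | inj₁ (inj₁ Dz) = inj₁ Dz
  ... | inj₁ (inj₂ (inj₁ refl)) = inj₂ (inj₁ (here refl))
  ... | inj₁ (inj₂ (inj₂ refl)) = inj₂ (inj₂ (here (θ-involutive d)))
  ... | inj₂ (inj₁ z∈) = inj₂ (inj₁ (there z∈))
  ... | inj₂ (inj₂ θz∈) = inj₂ (inj₂ (there θz∈))

-- Deletion of a set of vertices of odd degree

module Deletion (G : Graph) (S A : VSet G) (A⊆S : ∀ v → A v ≡ true → S v ≡ true)
                (indep : Independent G A)
                (odd : ∀ v → A v ≡ true → Odd (degree G S v)) where
  open Graph G
  open Surface G

  S' : VSet G
  S' v = S v ∧ not (A v)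

  private
    𝔻 = Dart G
    θᴳ : 𝔻 → 𝔻
    θᴳ = θ G
    vertᴳ : 𝔻 → Fin nV
    vertᴳ = vert G
    C = dartCounting G

  degᴬ : Fin nV → ℕ
  degᴬ v = if A v then degree G S v else 0

  atᵇ : Fin nV → 𝔻 → Bool
  atᵇ v d = inS S d ∧ does (vertᴳ d ≟ᶠ v)

  star : Fin nV → List 𝔻
  star v = Enumeration.list (enumerate C (atᵇ v))

  star-sound : ∀ {v d} → d ∈ star v → DartIn G S d × vertᴳ d ≡ v
  star-sound {v} {d} d∈ with ∧-elim {inS S d} (Enumeration.sound (enumerate C (atᵇ v)) d∈)
  ... | i , eq with vertᴳ d ≟ᶠ v
  ...   | yes p = i , p

  star-complete : ∀ {v d} → DartIn G S d → vertᴳ d ≡ v → d ∈ star v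
  star-complete {v} {d} i eq = Enumeration.complete (enumerate C (atᵇ v)) (∧-intro i at)
    where
    at : does (vertᴳ d ≟ᶠ v) ≡ true
    at with vertᴳ d ≟ᶠ v
    ... | yes _ = refl
    ... | no ≢v = contradiction eq ≢v

  far-end : ∀ d → A (vertᴳ d) ≡ true → ¬ A (vertᴳ (θᴳ d)) ≡ true
  far-end (e , false) a a' = indep e (a , a')
  far-end (e , true)  a a' = indep e (a' , a)

  far-end-in-S' : ∀ d → DartIn G S d → A (vertᴳ d) ≡ true → S' (vertᴳ (θᴳ d)) ≡ true
  far-end-in-S' d i a with A (vertᴳ (θᴳ d)) in eq
  ... | true  = contradiction eq (far-end d a)
  ... | false = ∧-intro (vert-inside S (θᴳ d) i) refl

  S'-not-A : ∀ {v} → S' v ≡ true → ¬ A v ≡ true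
  S'-not-A {v} s' a with proj₂ (∧-elim {S v} s')
  ... | na rewrite a = contradiction na λ ()

  S'⊆S : ∀ d → DartIn G S' d → DartIn G S d
  S'⊆S (e , b) i = ∧-intro (inside (vert-inside S' (e , false) i)) (inside (vert-inside S' (e , true) i))
    where
    inside : ∀ {v} → S' v ≡ true → S v ≡ true
    inside {v} = proj₁ ∘ ∧-elim {S v}

  in-S'-or-A : ∀ d → DartIn G S d → DartIn G S' d ⊎ A (vertᴳ d) ≡ true ⊎ A (vertᴳ (θᴳ d)) ≡ true
  in-S'-or-A (e , b) i with A (end e false) in a | A (end e true) in a'
  in-S'-or-A (e , false) i | true  | _     = inj₂ (inj₁ a)
  in-S'-or-A (e , true)  i | true  | _     = inj₂ (inj₂ a)
  in-S'-or-A (e , false) i | false | true  = inj₂ (inj₂ a')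
  in-S'-or-A (e , true)  i | false | true  = inj₂ (inj₁ a')
  in-S'-or-A (e , b)     i | false | false = inj₁ (∧-intro
    (∧-intro (vert-inside S (e , false) i) refl) (∧-intro (vert-inside S (e , true) i) refl))

  record Stage (vs : List (Fin nV)) (P : 𝔻 → Set) : Set where
    field
      within   : ∀ {z} → P z → DartIn G S z
      θ-closed : ∀ {z} → P z → P (θᴳ z)
      unused   : ∀ {v z} → v ∈ vs → A v ≡ true → P z → vertᴳ z ≢ v

  Anchored : (𝔻 → Set) → Set
  Anchored P = ∀ u → S' u ≡ true → ∃ λ y → P y × vertᴳ y ≡ u

  Stage-skip : ∀ {v vs P} → Stage (v ∷ vs) P → Stage vs P
  Stage-skip st = record { within = within ; θ-closed = θ-closed ; unused = unused ∘ there }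
    where open Stage st

  Stage-star : ∀ {v vs P} → A v ≡ true → All (v ≢_) vs → Stage (v ∷ vs) P → Stage vs (P ⊞ star v)
  Stage-star {v} {vs} {P} a v∉ st = record { within = within' ; θ-closed = θ-closed' ; unused = unused' }
    where
    open Stage st
    within' : ∀ {z} → (P ⊞ star v) z → DartIn G S z
    within' p with ⊞-elim (star v) p
    ... | inj₁ q = within q
    ... | inj₂ (inj₁ z∈) = proj₁ (star-sound z∈)
    ... | inj₂ (inj₂ θz∈) = proj₁ (star-sound θz∈)
    θ-closed' : ∀ {z} → (P ⊞ star v) z → (P ⊞ star v) (θᴳ z)
    θ-closed' p with ⊞-elim (star v) p
    ... | inj₁ q = ⊞-mono (star v) (θ-closed q)
    ... | inj₂ (inj₁ z∈) = proj₂ (⊞-∈ z∈)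
    ... | inj₂ (inj₂ θz∈) = proj₁ (⊞-∈ θz∈)
    unused' : ∀ {w z} → w ∈ vs → A w ≡ true → (P ⊞ star v) z → vertᴳ z ≢ w
    unused' {w} {z} w∈ aw p refl with ⊞-elim (star v) p
    ... | inj₁ q = unused (there w∈) aw q refl
    ... | inj₂ (inj₁ z∈) = All.lookup v∉ w∈ (sym (proj₂ (star-sound z∈)))
    ... | inj₂ (inj₂ θz∈) = far-end z aw (subst (λ u → A u ≡ true) (sym (proj₂ (star-sound θz∈))) a)

  star-attachable : ∀ {v vs P} → A v ≡ true → Stage (v ∷ vs) P → Anchored P → All (Attachable v P) (star v)
  star-attachable {v} {vs} {P} a st anchors = All.tabulate attachable
    where
    open Stage st
    attachable : ∀ {d} → d ∈ star v → Attachable v P d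
    attachable {d} d∈ with star-sound d∈
    ... | i , refl = record
      { at-v = refl
      ; no-loop = λ eq → far-end d a (trans (cong A eq) a)
      ; absent = λ p → unused (here refl) a p refl
      ; absentθ = λ p → unused (here refl) a (subst P (θ-involutive d) (θ-closed p)) refl
      ; anchor = anchors _ (far-end-in-S' d i a)
      }

  star-odd : ∀ {v} → A v ≡ true → ∃ λ k → length (star v) ≡ suc (2 * k)
  star-odd {v} a with odd v a
  ... | k , eq = k , trans (Enumeration.size (enumerate C (atᵇ v))) eq

  star-length : ∀ {v} → A v ≡ true → length (star v) ≡ degᴬ v
  star-length {v} a rewrite a = Enumeration.size (enumerate C (atᵇ v))

  record Completion (P : 𝔻 → Set) (vs : List (Fin nV)) (m : ℕ) : Set₁ where
    field
      darts   : 𝔻 → Set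
      perm    : Perm 𝔻
      extends : ∀ {z} → P z → darts z
      stage   : Stage [] darts
      covers  : ∀ {v z} → v ∈ vs → A v ≡ true → DartIn G S z → vertᴳ z ≡ v → darts z
      partial : Partial darts perm
      bound   : faceCount perm + sum (map degᴬ vs) ≤ m

  skip : ∀ {P v vs m} → A v ≡ false → Completion P vs m → Completion P (v ∷ vs) m
  skip {P} {v} {vs} a c = record
    { darts = darts ; perm = perm ; extends = extends ; stage = stage
    ; covers = λ { (here refl) av → ⊥-elim (true≢false av a) ; (there v∈) → covers v∈ }
    ; partial = partial
    ; bound = subst (λ b → faceCount perm + ((if b then degree G S v else 0) + sum (map degᴬ vs)) ≤ _) (sym a) bound
    }
    where open Completion c

  attach : ∀ {P v vs m n} → A v ≡ true → m + length (star v) ≤ n → Completion (P ⊞ star v) vs m → Completion P (v ∷ vs) n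
  attach {P} {v} {vs} {m} {n} a le c = record
    { darts = darts ; perm = perm ; extends = extends ∘ ⊞-mono (star v) ; stage = stage
    ; covers = λ { (here refl) av i eq → extends (proj₁ (⊞-∈ (star-complete i eq))) ; (there v∈) → covers v∈ }
    ; partial = partial
    ; bound = begin
        f + (degᴬ v + t)          ≡⟨ cong (f +_) (+-comm (degᴬ v) t) ⟩
        f + (t + degᴬ v)          ≡⟨ +-assoc f t _ ⟨
        f + t + degᴬ v            ≤⟨ +-mono-≤ bound (≤-reflexive (sym (star-length a))) ⟩
        m + length (star v)       ≤⟨ le ⟩
        n                         ∎
    }
    where
    open Completion c
    open ≤-Reasoning
    f = faceCount perm
    t = sum (map degᴬ vs)

  done : ∀ {P ρ m} → Stage [] P → Partial P ρ → faceCount ρ ≤ m → Completion P [] m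
  done {P} {ρ} st pr le = record
    { darts = P ; perm = ρ ; extends = λ p → p ; stage = st ; covers = λ () ; partial = pr
    ; bound = ≤-trans (≤-reflexive (+-identityʳ _)) le }

  star-unique : ∀ v → Unique (star v)
  star-unique v = Enumeration.unique (enumerate C (atᵇ v))

  complete : ∀ vs {P ρ} → Unique vs → Stage vs P → Anchored P → Partial P ρ → Completion P vs (faceCount ρ)
  complete [] u st anchors pr = done st pr ≤-refl
  complete (v ∷ vs) (v∉ ∷ u) st anchors pr with A v in a
  ... | false = skip a (complete vs u (Stage-skip st) anchors pr)
  ... | true with star-odd a
  ...   | k , odd-length with insert-odd k (star v) odd-length pr (Stage.unused st (here refl) a) (star-unique v) (star-attachable a st anchors)
  ...     | ρ' , pr' , le = attach a le (complete vs u (Stage-star a v∉ st)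
              (λ u su → let y , py , eq = anchors u su in y , ⊞-mono (star v) py , eq) pr')

  -- Nothing happens before the first vertex of `A`; its star gives the sole vertex of `S'` a dart,
  -- and from then on `complete` applies.
  complete-empty : ∀ vs {P ρ} → Unique vs → Stage vs P → (∀ {z} → ¬ P z) → (∀ u w → S' u ≡ true → S' w ≡ true → u ≡ w) →
                   Partial P ρ → Completion P vs (suc (faceCount ρ))
  complete-empty [] u st empty point pr = done st pr (n≤1+n _)
  complete-empty (v ∷ vs) (v∉ ∷ u) st empty point pr with A v in a
  ... | false = skip a (complete-empty vs u (Stage-skip st) empty point pr)
  ... | true with star-odd a
  ...   | k , odd-length with nonempty odd-length
  ...     | d , d∈ with star-sound d∈
  ...       | i , vd = first
    where
    in-S' : ∀ {d'} → DartIn G S d' → vertᴳ d' ≡ v → S' (vertᴳ (θᴳ d')) ≡ true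
    in-S' {d'} i' vd' = far-end-in-S' d' i' (trans (cong A vd') a)
    first : Completion _ (v ∷ vs) _
    first with insert-first k (star v) odd-length pr empty (λ eq → S'-not-A (in-S' {d} i vd) (trans (cong A eq) a)) (star-unique v)
                 (All.tabulate λ {d'} d'∈ → let i' , vd' = star-sound d'∈ in vd' , point _ _ (in-S' {d'} i' vd') (in-S' {d} i vd))
    ... | ρ' , pr' , le = attach a le (complete vs u (Stage-star a v∉ st)
            (λ u su → θᴳ d , proj₂ (⊞-∈ d∈) , point _ _ (in-S' {d} i vd) su) pr')

  -- Vertices and edges lost by the deletion

  nVerts-split : nVerts G S ≡ nVerts G S' + count A
  nVerts-split = trans (sumFin-cong split) (sumFin-+ (bit ∘ S') (bit ∘ A))
    where
    split : ∀ v → bit (S v) ≡ bit (S' v) + bit (A v)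
    split v with A v in a
    ... | true rewrite A⊆S v a = refl
    ... | false with S v
    ...   | true  = refl
    ...   | false = refl

  -- Double counting of the incidences `h`: rows give degrees, and in its column each lost edge
  -- counts once, having exactly one end in `A` by independence.
  nEdges-split : nEdges G S ≡ nEdges G S' + sumFin degᴬ
  nEdges-split = begin
    nEdges G S                                        ≡⟨ sumFin-cong split ⟩
    sumFin (λ e → bit (edgeInᵇ G S' e) + ends e)      ≡⟨ sumFin-+ (bit ∘ edgeInᵇ G S') ends ⟩
    nEdges G S' + sumFin ends                         ≡⟨ cong (nEdges G S' +_) (sumFin-cong λ e → sym (column e)) ⟩
    nEdges G S' + sumFin (λ e → sumFin λ v → h v e)   ≡⟨ cong (nEdges G S' +_) (sym (sumFin-exchange h)) ⟩
    nEdges G S' + sumFin (λ v → sumFin (h v))         ≡⟨ cong (nEdges G S' +_) (sumFin-cong λ v → row v) ⟩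
    nEdges G S' + sumFin degᴬ                         ∎
    where
    open ≡-Reasoning
    at : Fin nV → 𝔻 → ℕ
    at v d = if A v then bit (atᵇ v d) else 0
    h : Fin nV → Fin nE → ℕ
    h v e = at v (e , false) + at v (e , true)
    ends : Fin nE → ℕ
    ends e = bit (edgeInᵇ G S e ∧ A (end e false)) + bit (edgeInᵇ G S e ∧ A (end e true))
    row : ∀ v → sumFin (h v) ≡ degᴬ v
    row v with A v
    ... | true  = refl
    ... | false = sumFin-zero nE
    at-end : ∀ d → sumFin (λ v → at v d) ≡ bit (inS S d ∧ A (vertᴳ d))
    at-end d = trans (sumFin-single (λ v → at v d) (vertᴳ d) off) on
      where
      off : ∀ v → v ≢ vertᴳ d → at v d ≡ 0
      off v v≢ with A v | inS S d | vertᴳ d ≟ᶠ v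
      ... | false | _ | _ = refl
      ... | true | false | _ = refl
      ... | true | true | no _ = refl
      ... | true | true | yes eq = contradiction (sym eq) v≢
      on : at (vertᴳ d) d ≡ bit (inS S d ∧ A (vertᴳ d))
      on with A (vertᴳ d) | inS S d | vertᴳ d ≟ᶠ vertᴳ d
      ... | false | false | _ = refl
      ... | false | true  | _ = refl
      ... | true | false | _ = refl
      ... | true | true | yes _ = refl
      ... | true | true | no v≢v = contradiction refl v≢v
    column : ∀ e → sumFin (λ v → h v e) ≡ ends e
    column e = trans (sumFin-+ (λ v → at v (e , false)) (λ v → at v (e , true))) (cong₂ _+_ (at-end (e , false)) (at-end (e , true)))
    split : ∀ e → bit (edgeInᵇ G S e) ≡ bit (edgeInᵇ G S' e) + ends e
    split e with A (end e false) in a | A (end e true) in a'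
    ... | true | true = ⊥-elim (indep e (a , a'))
    ... | true | false rewrite A⊆S _ a with S (end e true)
    ...   | true  = refl
    ...   | false = refl
    split e | false | true rewrite A⊆S _ a' with S (end e false)
    ...   | true  = refl
    ...   | false = refl
    split e | false | false with S (end e false) | S (end e true)
    ...   | true  | true  = refl
    ...   | true  | false = refl
    ...   | false | _     = refl

  outside-split : count (not ∘ edgeInᵇ G S') ≡ count (not ∘ edgeInᵇ G S) + sumFin degᴬ
  outside-split = +-cancelˡ-≡ (nEdges G S') _ _ (begin
    nEdges G S' + count (not ∘ edgeInᵇ G S')                  ≡⟨ count-complement (edgeInᵇ G S') ⟩
    nE                                                        ≡⟨ count-complement (edgeInᵇ G S) ⟨
    nEdges G S + out                                          ≡⟨ cong (_+ out) nEdges-split ⟩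
    nEdges G S' + sumFin degᴬ + out                           ≡⟨ +-assoc (nEdges G S') _ out ⟩
    nEdges G S' + (sumFin degᴬ + out)                         ≡⟨ cong (nEdges G S' +_) (+-comm _ out) ⟩
    nEdges G S' + (out + sumFin degᴬ)                         ∎)
    where
    open ≡-Reasoning
    out = count (not ∘ edgeInᵇ G S)

  -- Extending a rotation from the smaller graph to the larger

  module _ (conn : Connected G S') (r' : Rotation G S') where

    partial-rotation : Partial (DartIn G S') (ρ̂ r')
    partial-rotation = record
      { fixes = λ {d} ¬i → ρ̂-outside r' (outside d ¬i) ; at-vert = ρ̂-vert r' ; one-cycle = ρ̂-cyclic r' }
      where
      outside : ∀ d → ¬ DartIn G S' d → inS S' d ≡ false
      outside d ¬i with inS S' d
      ... | true  = contradiction refl ¬i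
      ... | false = refl

    first-stage : ∀ vs → Stage vs (DartIn G S')
    first-stage vs = record
      { within = λ {z} → S'⊆S z
      ; θ-closed = λ p → p
      ; unused = λ { {z = z} _ a p refl → S'-not-A (vert-inside S' z p) a }
      }

    finish : ∀ {m} → Completion (DartIn G S') (allFin nV) m →
             ∃ λ (r : Rotation G S) → faceOrbits r + count (not ∘ edgeInᵇ G S) + sumFin degᴬ ≤ m
    finish c = r , ≤-trans (≤-reflexive (cong₂ _+_ (sym (orbits-φ̂ r)) (trans (sym (sum-tabulate degᴬ)) (cong sum (sym (map-tabulate (λ v → v) degᴬ))))))
                     (≤-trans (+-monoˡ-≤ _ (orbits-cong same)) bound)
      where
      open Completion c
      open Partial partial
      inside : ∀ {d} → DartIn G S d → darts d
      inside {d} i with in-S'-or-A d i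
      ... | inj₁ i' = extends i'
      ... | inj₂ (inj₁ a) = covers (∈-allFin _) a i refl
      ... | inj₂ (inj₂ a) = subst darts (θ-involutive d) (Stage.θ-closed stage (covers {z = θᴳ d} (∈-allFin _) a i refl))
      outside : ∀ {d} → inS S d ≡ false → to perm d ≡ d
      outside {d} ni = fixes λ p → true≢false (Stage.within stage p) ni
      closed : ∀ d → DartIn G S d → DartIn G S (to perm d)
      closed d i with inS S (to perm d) in eq
      ... | true  = refl
      -- An image outside G[S] is a fixed point, so by injectivity `d` equals its image and lies
      -- outside as well.
      ... | false = ⊥-elim (true≢false i (subst (λ z → inS S z ≡ false) (Perm.to-injective perm (outside {to perm d} eq)) eq))
      r : Rotation G S
      r = record
        { ρ = to perm ; ρ⁻¹ = Perm.from perm ; ρρ⁻¹ = Perm.to-from perm ; ρ⁻¹ρ = Perm.from-to perm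
        ; closed = closed
        ; atVert = λ d _ → at-vert d
        ; cyclic = λ d d' i i' eq → one-cycle (inside i) (inside i') eq
        }
      same : ∀ d → to (φ̂ r) d ≡ Φ perm d
      same d with inS S d in i
      ... | true  = refl
      ... | false = sym (outside {θᴳ d} i)

    no-more-faces : ∀ {m} (r : Rotation G S) →
      faceOrbits r + count (not ∘ edgeInᵇ G S) + sumFin degᴬ ≤ m + count (not ∘ edgeInᵇ G S') → faceOrbits r ≤ m
    no-more-faces {m} r le = +-cancelʳ-≤ out' _ _ (begin
      faceOrbits r + out'                ≡⟨ cong (faceOrbits r +_) outside-split ⟩
      faceOrbits r + (out + sumFin degᴬ) ≡⟨ +-assoc (faceOrbits r) out _ ⟨
      faceOrbits r + out + sumFin degᴬ   ≤⟨ le ⟩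
      m + out'                           ∎)
      where
      open ≤-Reasoning
      out = count (not ∘ edgeInᵇ G S)
      out' = count (not ∘ edgeInᵇ G S')

    -- If G[S'] has an edge, the first step of a walk towards it gives every vertex of `S'` a dart.
    -- If not, there are no face orbits, and the extra orbit of `complete-empty` fits into the
    -- default face 1.
    extend-rotation : ∃ λ (r : Rotation G S) → faces G r ≤ faces G r'
    extend-rotation with nEdges G S' in eq
    ... | suc m = with-edge (Counting.#-find (finCounting nE) (edgeInᵇ G S') eq)
      where
      with-edge : ∃ (λ e → edgeInᵇ G S' e ≡ true) → ∃ λ (r : Rotation G S) → faces G r ≤ faces G r'
      with-edge (e , i) = r , ⊔-monoʳ-≤ 1 (no-more-faces r (≤-trans (proj₂ finished) (≤-reflexive (orbits-φ̂ r'))))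
        where
        first-dart : ∀ {u} → Walk G S' u (end e false) → ∃ λ y → DartIn G S' y × vertᴳ y ≡ u
        first-dart Walk.here = (e , false) , i , refl
        first-dart (Walk.step e' b i' eq _) = (e' , b) , i' , eq
        anchors : Anchored (DartIn G S')
        anchors u su = first-dart (proj₂ conn u _ su (vert-inside S' (e , false) i))
        finished = finish (complete (allFin nV) (allFin⁺ nV) (first-stage _) anchors partial-rotation)
        r = proj₁ finished
    ... | zero = r , ⊔-lub (m≤m⊔n 1 (faceOrbits r')) (≤-trans (≤-trans (no-more-faces r (≤-trans (proj₂ finished)
                       (s≤s (≤-reflexive (orbits-φ̂ r'))))) (s≤s no-faces)) (m≤m⊔n 1 (faceOrbits r')))
      where
      empty : ∀ {e} → ¬ edgeInᵇ G S' e ≡ true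
      empty {e} i = contradiction (trans (sym eq) (∖-# (finCounting nE) (edgeInᵇ G S') e i)) λ ()
      point : ∀ u w → S' u ≡ true → S' w ≡ true → u ≡ w
      point u w su sw with proj₂ conn u w su sw
      ... | Walk.here = refl
      ... | Walk.step e b i _ _ = contradiction i empty
      no-faces : faceOrbits r' ≤ 0
      no-faces with faceOrbits r' in c
      ... | zero = z≤n
      ... | suc _ with Counting.#-find C (isRep G r') c
      ...   | d , p = contradiction (proj₁ (∧-elim {inS S' d} p)) empty
      finished = finish (complete-empty (allFin nV) (allFin⁺ nV) (first-stage _) empty point partial-rotation)
      r = proj₁ finished

-- From faces to genus and cycle rank

genus≤⌊β/2⌋ : ∀ (G : Graph) {S} (r : Rotation G S) → genus G r ≤ ⌊ β G S /2⌋
genus≤⌊β/2⌋ G {S} r = ⌊n/2⌋-mono (begin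
  (2 + E) ∸ (V + faces G r)  ≤⟨ ∸-monoʳ-≤ (2 + E) (+-monoʳ-≤ V (m≤m⊔n 1 (Surface.faceOrbits G r))) ⟩
  (2 + E) ∸ (V + 1)          ≡⟨ cong₂ _∸_ (cong suc (+-comm 1 E)) (+-comm V 1) ⟩
  (E + 1) ∸ V                ∎)
  where
  open ≤-Reasoning
  E = nEdges G S
  V = nVerts G S

module Genus (G : Graph) (S A : VSet G) (A⊆S : ∀ v → A v ≡ true → S v ≡ true)
             (indep : Independent G A) (odd : ∀ v → A v ≡ true → Odd (degree G S v))
             (conn : Connected G (λ v → S v ∧ not (A v))) where
  open Deletion G S A A⊆S indep odd

  gain : ℕ
  gain = sumFin λ v → if A v then degree G S v ∸ 1 else 0

  private
    E = nEdges G S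
    E' = nEdges G S'
    V = nVerts G S
    V' = nVerts G S'
    a = count A
    open +-*-Solver

  gain-even : ∃ λ h → gain ≡ 2 * h
  gain-even = sumFin-even _ even
    where
    even : ∀ v → ∃ λ h → (if A v then degree G S v ∸ 1 else 0) ≡ 2 * h
    even v with A v in av
    ... | false = 0 , refl
    ... | true with odd v av
    ...   | k , eq = k , cong (_∸ 1) eq

  E-split : E ≡ E' + (gain + a)
  E-split = trans nEdges-split (cong (E' +_) (trans (sumFin-cong pointwise) (sumFin-+ _ (bit ∘ A))))
    where
    pointwise : ∀ v → degᴬ v ≡ (if A v then degree G S v ∸ 1 else 0) + bit (A v)
    pointwise v with A v in av
    ... | false = refl
    ... | true with odd v av
    ...   | k , eq rewrite eq = +-comm 1 (2 * k)

  -- Beyond the `a` new vertices there are `gain` new edges and no new faces, so the Euler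
  -- expression grows by at least `gain`; as `gain` is even, halving with rounding down is additive.
  genus-gain : (r' : Rotation G S') → ∃ λ (r : Rotation G S) → gain + 2 * genus G r' ≤ 2 * genus G r
  genus-gain r' with extend-rotation conn r' | gain-even
  ... | r , f≤f' | h , gain≡ = r , (begin
    gain + 2 * ⌊ x' /2⌋        ≡⟨ cong (_+ 2 * ⌊ x' /2⌋) gain≡ ⟩
    2 * h + 2 * ⌊ x' /2⌋       ≡⟨ trans (sym (*-distribˡ-+ 2 h ⌊ x' /2⌋)) (cong (2 *_) (+-comm h ⌊ x' /2⌋)) ⟩
    2 * (⌊ x' /2⌋ + h)         ≡⟨ cong (2 *_) (⌊n+2*h/2⌋ x' h) ⟨
    2 * ⌊ x' + 2 * h /2⌋       ≡⟨ cong (λ g → 2 * ⌊ x' + g /2⌋) gain≡ ⟨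
    2 * ⌊ x' + gain /2⌋        ≤⟨ *-monoʳ-≤ 2 (⌊n/2⌋-mono (m+n≤o⇒m≤o∸n (x' + gain) exponent)) ⟩
    2 * genus G r              ∎)
    where
    open ≤-Reasoning
    f = faces G r
    f' = faces G r'
    x' = (2 + E') ∸ (V' + f')
    exponent : x' + gain + (V + f) ≤ 2 + E
    exponent = begin
      x' + gain + (V + f)           ≤⟨ +-monoʳ-≤ (x' + gain) (+-mono-≤ (≤-reflexive nVerts-split) f≤f') ⟩
      x' + gain + (V' + a + f')     ≡⟨ solve 5 (λ x g v a f → x :+ g :+ (v :+ a :+ f) := x :+ (v :+ f) :+ (g :+ a)) refl x' gain V' a f' ⟩
      -- Euler's inequality makes the truncated subtraction in `x'` exact.
      x' + (V' + f') + (gain + a)   ≡⟨ cong (_+ (gain + a)) (m∸n+n≡m (≤-trans (Surface.Euler.euler G conn r') (≤-reflexive (+-comm E' 2)))) ⟩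
      2 + E' + (gain + a)           ≡⟨ cong (2 +_) E-split ⟨
      2 + E                         ∎

  -- The rotation yields, through Euler's inequality and the face that always exists, `V' ≤ E' + 1`,
  -- so that `β G S'` is not truncated.
  β-gain : Rotation G S' → β G S ≡ gain + β G S'
  β-gain r' = begin
    (E + 1) ∸ V                            ≡⟨ cong₂ _∸_ (cong (_+ 1) E-split) nVerts-split ⟩
    (E' + (gain + a) + 1) ∸ (V' + a)       ≡⟨ cong (_∸ (V' + a)) (solve 3 (λ e g a → e :+ (g :+ a) :+ con 1 := g :+ (e :+ con 1) :+ a) refl E' gain a) ⟩
    (gain + (E' + 1) + a) ∸ (V' + a)       ≡⟨ trans (cong₂ _∸_ (+-comm _ a) (+-comm V' a)) ([m+n]∸[m+o]≡n∸o a (gain + (E' + 1)) V') ⟩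
    (gain + (E' + 1)) ∸ V'                 ≡⟨ +-∸-assoc gain V'≤ ⟩
    gain + β G S'                          ∎
    where
    open ≡-Reasoning
    V'≤ : V' ≤ E' + 1
    V'≤ = +-cancelʳ-≤ 1 _ _ (≤-trans (+-monoʳ-≤ V' (m≤m⊔n 1 (Surface.faceOrbits G r')))
            (≤-trans (Surface.Euler.euler G conn r') (≤-reflexive (sym (+-assoc E' 1 1)))))

  maxGenus-gain : ∀ {k k'} → IsMaxGenus G S k → IsMaxGenus G S' k' → gain + 2 * k' ≤ 2 * k
  maxGenus-gain (_ , max) ((r' , refl) , _) = let r , le = genus-gain r' in ≤-trans le (*-monoʳ-≤ 2 (max r))

  -- Half the cycle rank, rounded down, bounds every genus, so one rotation reaching it is enough.
  -- Extending an optimal rotation of the smaller graph does: the bound grows by half of the even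
  -- number `gain`, the genus by at least as much.
  upperEmbeddable-gain : UpperEmbeddable G S' → UpperEmbeddable G S
  upperEmbeddable-gain (_ , ((r' , refl) , _) , g'≡) with genus-gain r' | gain-even
  ... | r , le | h , gain≡ = ⌊ β G S /2⌋ , ((r , ≤-antisym (genus≤⌊β/2⌋ G r) (*-cancelˡ-≤ 2 twice)) , genus≤⌊β/2⌋ G) , refl
    where
    open ≤-Reasoning
    twice : 2 * ⌊ β G S /2⌋ ≤ 2 * genus G r
    twice = begin
      2 * ⌊ β G S /2⌋                ≡⟨ cong (λ b → 2 * ⌊ b /2⌋) (trans (β-gain r') (trans (cong (_+ β G S') gain≡) (+-comm (2 * h) _))) ⟩
      2 * ⌊ β G S' + 2 * h /2⌋       ≡⟨ cong (2 *_) (⌊n+2*h/2⌋ (β G S') h) ⟩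
      2 * (⌊ β G S' /2⌋ + h)         ≡⟨ trans (cong (2 *_) (+-comm ⌊ β G S' /2⌋ h)) (*-distribˡ-+ 2 h ⌊ β G S' /2⌋) ⟩
      2 * h + 2 * ⌊ β G S' /2⌋       ≡⟨ cong₂ (λ x y → x + 2 * y) (sym gain≡) (sym g'≡) ⟩
      gain + 2 * genus G r'          ≤⟨ le ⟩
      2 * genus G r                  ∎

theoremC : (G : Graph) (s : ℕ) (A : ℕ → VSet G) →
    Connected G (Gseq G A 0) →
    (∀ i → 1 ≤ i → i ≤ s → Independent G (A i)) →
    (∀ i j → 1 ≤ i → i ≤ s → 1 ≤ j → j ≤ s → i ≢ j →
    ∀ v → A i v ≡ true → A j v ≡ true → ⊥) →
    (∀ i → 1 ≤ i → i ≤ s → Connected G (Gseq G A i)) →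
    (∀ i → i < s → ∀ v → A (suc i) v ≡ true → Odd (degree G (Gseq G A i) v)) →
    (∀ i → i < s → ∀ k k' →
    IsMaxGenus G (Gseq G A i) k → IsMaxGenus G (Gseq G A (suc i)) k' →
    sumFin (λ v → if A (suc i) v then degree G (Gseq G A i) v ∸ 1 else 0) + 2 * k'
    ≤ 2 * k)
    × ((∃ λ j → 1 ≤ j × j ≤ s × UpperEmbeddable G (Gseq G A j)) →
    UpperEmbeddable G (Gseq G A 0))
theoremC G s A _ indep disjoint conn odd =
  (λ i i<s k k' max max' → Step.maxGenus-gain i i<s max max') ,
  λ { (j , _ , j≤s , upper) → descend j j≤s upper }
  where
  -- Disjointness enters here: a vertex of `A (suc i)` survives the deletions of all earlier sets,
  -- so it is still a vertex of the graph from which it is removed.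
  not-deleted-before : ∀ i → i < s → ∀ v → A (suc i) v ≡ true → ∀ m → m ≤ i → Gseq G A m v ≡ true
  not-deleted-before i i<s v av zero    _   = refl
  not-deleted-before i i<s v av (suc m) m<i = ∧-intro (not-deleted-before i i<s v av m (<⇒≤ m<i)) not-in
    where
    not-in : not (A (suc m) v) ≡ true
    not-in with A (suc m) v in am
    ... | false = refl
    ... | true  = ⊥-elim (disjoint (suc m) (suc i) (s≤s z≤n) (<-trans m<i i<s) (s≤s z≤n) i<s
                    (λ { refl → <-irrefl refl m<i }) v am av)
  module Step i (i<s : i < s) = Genus G (Gseq G A i) (A (suc i))
    (λ v av → not-deleted-before i i<s v av i ≤-refl) (indep (suc i) (s≤s z≤n) i<s) (odd i i<s) (conn (suc i) (s≤s z≤n) i<s)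
  descend : ∀ j → j ≤ s → UpperEmbeddable G (Gseq G A j) → UpperEmbeddable G (Gseq G A 0)
  descend zero    _   upper = upper
  descend (suc j) j<s upper = descend j (<⇒≤ j<s) (Step.upperEmbeddable-gain j j<s upper)
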